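{- Let $G$ be a $k$-tree and let $\mathbb{S}$ be its set of minimal vertex separators. Then the number of clique trees of $G$ equals $$\prod_{S\in\mathbb{S}}\bigl(\mu(S)+1\bigr)^{\mu(S)-1}.$$
   Context: All graphs are finite and simple. A $k$-tree: $K_{k+1}$ is a $k$-tree, and adding to a $k$-tree a new vertex adjacent exactly to the vertices of a $k$-clique gives a $k$-tree. A minimal vertex separator (mvs) of $G$ is a set $S$ which, for some nonadjacent $u,v$, separates $u$ and $v$ into different components of $G-S$ while no proper subset does. The clique-intersection graph of a connected chordal graph $G$ has the maximal cliques as vertices, edges between intersecting maximal cliques, with weight $|Q\cap Q'|$; a clique tree of $G$ is a maximum-weight spanning tree of it (clique trees are counted as distinct trees on the labeled set of maximal cliques). For any clique tree, the sets $Q\cap Q'$ over its edges are exactly the mvs's and the multiset of them does not depend on the clique tree; the multiplicity $\mu(S)$ is the number of edges $\{Q,Q'\}$ of a clique tree with $Q\cap Q'=S$. -}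

module Defs where

open import Data.Nat using (ℕ; zero; suc; _+_; _*_; _∸_; _^_; _≤_; _<ᵇ_)
open import Data.Bool using (Bool; true; false; _∧_; if_then_else_; T)
import Data.Bool.Properties as BoolP
open import Data.Fin using (Fin; toℕ; punchIn)
open import Data.Fin.Subset using (Subset; _∈_; _∉_; _⊆_; _⊂_; _∩_; ∣_∣; Nonempty; ⊥)
open import Data.Vec using (Vec; lookup; tabulate)
open import Data.Vec.Properties using (≡-dec)
open import Data.List using (List; map; allFin)
open import Data.Nat.ListAction using (sum; product)
open import Data.Product using (Σ; ∃; _×_; _,_)
open import Relation.Nullary using (¬_)
open import Relation.Nullary.Decidable using (⌊_⌋)
open import Relation.Binary.PropositionalEquality using (_≡_; _≢_)

record Graph (n : ℕ) : Set where
  field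
    adj    : Fin n → Fin n → Bool
    sym    : ∀ u v → adj u v ≡ adj v u
    irrefl : ∀ u → adj u u ≡ false
open Graph public

Adj : ∀ {n} → Graph n → Fin n → Fin n → Set
Adj G u v = T (adj G u v)

delete : ∀ {n} → Fin (suc n) → Graph (suc n) → Graph n
delete v G = record
  { adj    = λ i j → adj G (punchIn v i) (punchIn v j)
  ; sym    = λ i j → sym G (punchIn v i) (punchIn v j)
  ; irrefl = λ i → irrefl G (punchIn v i) }

nbhd : ∀ {n} → Graph n → Fin n → Subset n
nbhd G v = tabulate (adj G v)

IsClique : ∀ {n} → Graph n → Subset n → Set
IsClique G C = ∀ {u v} → u ∈ C → v ∈ C → u ≢ v → Adj G u v

IsMaximalClique : ∀ {n} → Graph n → Subset n → Set
IsMaximalClique G C = IsClique G C × (∀ C′ → IsClique G C′ → C ⊆ C′ → C′ ≡ C)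

-- k-trees: K_{k+1} is a k-tree; adding to a k-tree a new vertex adjacent
-- exactly to the vertices of a k-clique gives a k-tree.  Since vertices are
-- labelled, the "new" vertex may be any vertex v of the larger graph.

data KTree (k : ℕ) : {n : ℕ} → Graph n → Set where
  base : (G : Graph (suc k)) → (∀ u v → u ≢ v → Adj G u v) → KTree k G
  step : ∀ {n} (G : Graph (suc n)) (v : Fin (suc n)) →
         KTree k (delete v G) →
         IsClique G (nbhd G v) → ∣ nbhd G v ∣ ≡ k →
         KTree k G

data Walk {n : ℕ} (R : Fin n → Fin n → Bool) (S : Subset n) : Fin n → Fin n → Set where
  here  : ∀ {u} → u ∉ S → Walk R S u u
  there : ∀ {u w v} → u ∉ S → T (R u w) → Walk R S w v → Walk R S u v

Separates : ∀ {n} → Graph n → Subset n → Fin n → Fin n → Set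
Separates G S u v = u ∉ S × v ∉ S × ¬ Walk (adj G) S u v

IsMVS : ∀ {n} → Graph n → Subset n → Set
IsMVS G S = ∃ λ u → ∃ λ v → ¬ Adj G u v ×
              Separates G S u v × (∀ S′ → S′ ⊂ S → ¬ Separates G S′ u v)

∑ : ∀ {m} → (Fin m → ℕ) → ℕ
∑ {m} f = sum (map f (allFin m))

prod : List ℕ → ℕ
prod = product

-- Clique trees.  The maximal cliques are enumerated as Q : Fin m → Subset n;
-- a candidate tree on them is a (symmetric, irreflexive) adjacency matrix.

EdgeSet : ℕ → Set
EdgeSet m = Vec (Vec Bool m) m

_⟨_,_⟩ : ∀ {m} → EdgeSet m → Fin m → Fin m → Bool
E ⟨ i , j ⟩ = lookup (lookup E i) j

edgeSum : ∀ {m} → EdgeSet m → (Fin m → Fin m → ℕ) → ℕ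
edgeSum E f = ∑ λ i → ∑ λ j → if (toℕ i <ᵇ toℕ j) ∧ E ⟨ i , j ⟩ then f i j else 0

numEdges : ∀ {m} → EdgeSet m → ℕ
numEdges E = edgeSum E (λ _ _ → 1)

weight : ∀ {n m} → (Fin m → Subset n) → EdgeSet m → ℕ
weight Q E = edgeSum E (λ i j → ∣ Q i ∩ Q j ∣)

-- Spanning tree of the clique-intersection graph (vertices Fin m, edges
-- between distinct intersecting cliques): a connected subgraph with m - 1 edges.
IsSpanningTreeCI : ∀ {n m} → (Fin m → Subset n) → EdgeSet m → Set
IsSpanningTreeCI {m = m} Q E =
  (∀ i j → E ⟨ i , j ⟩ ≡ E ⟨ j , i ⟩) ×
  (∀ i → E ⟨ i , i ⟩ ≡ false) ×
  (∀ i j → T (E ⟨ i , j ⟩) → Nonempty (Q i ∩ Q j)) ×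
  (∀ i j → Walk (_⟨_,_⟩ E) ⊥ i j) ×
  numEdges E ≡ m ∸ 1

IsCliqueTree : ∀ {n m} → (Fin m → Subset n) → EdgeSet m → Set
IsCliqueTree Q E =
  IsSpanningTreeCI Q E × (∀ E′ → IsSpanningTreeCI Q E′ → weight Q E′ ≤ weight Q E)

EnumMaxCliques : ∀ {n m} → Graph n → (Fin m → Subset n) → Set
EnumMaxCliques G Q =
  (∀ i j → Q i ≡ Q j → i ≡ j) ×
  (∀ i → IsMaximalClique G (Q i)) ×
  (∀ C → IsMaximalClique G C → ∃ λ i → Q i ≡ C)

μ : ∀ {n m} → (Fin m → Subset n) → EdgeSet m → Subset n → ℕ
μ Q E S = edgeSum E (λ i j → if ⌊ ≡-dec BoolP._≟_ (Q i ∩ Q j) S ⌋ then 1 else 0)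

{-# OPTIONS --safe #-}
-- In a k-tree the maximal cliques are the (k+1)-cliques, and two of them meet
-- in at most k vertices, so the clique trees are the spanning trees all of
-- whose edges have weight k.  Root them at the initial clique ρ.  Every other
-- clique C was attached to the graph along a k-clique sep C, and in any clique
-- tree the parent of C is either the first clique containing sep C or another
-- clique attached along sep C.  Hence a clique tree is an independent choice,
-- for each separator S, of a rooted tree on the μ(S) cliques attached along S
-- and one root, and there are (μ(S) + 1)^(μ(S) - 1) of these.  That number is
-- found by contracting the vertices one by one into their parents.

module Submission where

open import Defs
open import Data.Nat using (ℕ; _+_; _∸_; _^_; _≤_)
open import Data.Fin using (Fin)
open import Data.Fin.Subset using (Subset)
open import Data.List using (List; map; length)
open import Data.List.Membership.Propositional using (_∈_)
open import Data.List.Relation.Unary.Unique.Propositional using (Unique)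
open import Data.Product using (Σ; ∃; _×_)
open import Function.Bundles using (_⇔_)
open import Relation.Binary.PropositionalEquality using (_≡_)

open import Data.Bool using (Bool; true; false; T; _∧_; _∨_; not; if_then_else_)
open import Data.Bool.Properties using (T-≡; ∨-comm; T-∨; T?)
open import Data.Empty using (⊥-elim)
open import Data.Fin using (zero; suc; toℕ; punchIn)
import Data.Bool.Properties as Bool
import Data.Fin.Properties as Fin
open import Data.Fin.Subset using (⊤; _∩_; ∣_∣; _⊂_; Nonempty) renaming (_∈_ to _∈ₛ_; _∉_ to _∉ₛ_; _⊆_ to _⊆ₛ_; ⊥ to ∅)
import Data.Fin.Subset.Properties as Subset
open import Data.List using ([]; _∷_; concatMap; filter; allFin) renaming (tabulate to tabulateL)
import Data.List.Properties as List
open import Data.List.Membership.Propositional using (_∉_; find)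
import Data.List.Membership.Propositional.Properties as Membership
open import Data.List.Relation.Unary.All using (All; []; _∷_)
import Data.List.Relation.Unary.All as All
open import Data.List.Relation.Unary.Any using (here; there)
import Data.List.Relation.Unary.Any as Any
open import Data.List.Relation.Unary.AllPairs using ([]; _∷_)
import Data.List.Relation.Unary.Unique.Propositional.Properties as Unique
open import Data.Maybe using (Maybe; just; nothing)
import Data.Maybe.Properties as Maybe
open import Data.Nat using (zero; suc; _*_; _<_; _<ᵇ_; z≤n; s≤s; NonZero; _≤′_; ≤′-refl; ≤′-step)
open import Data.Nat.ListAction using (sum; product)
import Data.Nat.Properties as ℕ
open import Data.Nat.Tactic.RingSolver using (solve-∀)
open import Data.Product using (_,_; proj₁; proj₂; ∃₂)
open import Data.Sum using (_⊎_; inj₁; inj₂)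
open import Data.Vec using (Vec; []; _∷_; lookup; tabulate; insertAt; removeAt)
import Data.Vec.Properties as Vec
open import Function using (_∘_; id)
open import Function.Bundles using (mk⇔; module Equivalence)
open import Relation.Binary using (DecidableEquality)
open import Relation.Binary.PropositionalEquality using (_≢_; _≗_; refl; cong; cong₂; subst; trans; module ≡-Reasoning) renaming (sym to ≡-sym)
open import Relation.Nullary using (¬_; Dec; yes; no; contradiction; does; _×-dec_; _⊎-dec_; ¬?)
open import Relation.Nullary.Decidable using (⌊_⌋; decidable-stable)

-- Enumeration of rooted forests

-- An induction over the vertices needs a statement about more than one root: a contracted vertex
-- hands the options that stood for it to its parent, so later vertices have several ways to choose
-- the same parent. Hence options are tokens, and the formula proved is this: if M vertices share W
-- tokens, r of which stand for the root, there are r W^(M-1) forests. Contraction may change r but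
-- never W; the case needed is r = 1 and W = μ(S) + 1. The obstacle on the side of graphs is
-- direction. Two cliques meeting in k vertices were attached along the same separator, or one of
-- them is the first clique containing the separator of the other; a priori the parent of C could be
-- a clique D attached to C. This is excluded because the path from D to the root would pass through
-- C again. Conversely, independent choices never close a cycle, since all cliques attached along S
-- are younger than the first clique containing S. The edge from C to its parent then always has
-- intersection `sep C`, so in every clique tree μ(S) counts the cliques attached along S.

module _ {A : Set} where

  sum-map-+ : (f g : A → ℕ) (xs : List A) →
              sum (map (λ x → f x + g x) xs) ≡ sum (map f xs) + sum (map g xs)
  sum-map-+ f g []       = refl
  sum-map-+ f g (x ∷ xs) = trans (cong (f x + g x +_) (sum-map-+ f g xs)) (swap (f x) (g x) _ _)
    where
    swap : ∀ a b c d → (a + b) + (c + d) ≡ (a + c) + (b + d)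
    swap = solve-∀

  sum-map-*ʳ : (f : A → ℕ) (c : ℕ) (xs : List A) →
               sum (map (λ x → f x * c) xs) ≡ sum (map f xs) * c
  sum-map-*ʳ f c []       = refl
  sum-map-*ʳ f c (x ∷ xs) =
    trans (cong (f x * c +_) (sum-map-*ʳ f c xs)) (≡-sym (ℕ.*-distribʳ-+ c (f x) _))

  sum-map-1 : (xs : List A) → sum (map (λ _ → 1) xs) ≡ length xs
  sum-map-1 []       = refl
  sum-map-1 (x ∷ xs) = cong suc (sum-map-1 xs)

  product-map-* : (f g : A → ℕ) (xs : List A) →
                  product (map (λ x → f x * g x) xs) ≡ product (map f xs) * product (map g xs)
  product-map-* f g []       = refl
  product-map-* f g (x ∷ xs) =
    trans (cong (f x * g x *_) (product-map-* f g xs)) (swap (f x) (g x) _ _)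
    where
    swap : ∀ a b c d → (a * b) * (c * d) ≡ (a * c) * (b * d)
    swap = solve-∀

  map-cong-∈ : {B : Set} {f g : A → B} {xs : List A} →
               (∀ x → x ∈ xs → f x ≡ g x) → map f xs ≡ map g xs
  map-cong-∈ f≗g = List.map-cong-local (All.tabulate (λ {x} → f≗g x))

  length-concatMap : {B : Set} (f : A → List B) (xs : List A) →
                     length (concatMap f xs) ≡ sum (map (length ∘ f) xs)
  length-concatMap f []       = refl
  length-concatMap f (x ∷ xs) =
    trans (List.length-++ (f x)) (cong (length (f x) +_) (length-concatMap f xs))

  -- One list `ys` serves every `g`: `length-enum` splits off the factor of the same label before
  -- and after a contraction and compares the two remainders.
  product-isolate : {x₀ : A} {xs : List A} → Unique xs → x₀ ∈ xs →
                    ∃ λ ys → (∀ g → product (map g xs) ≡ g x₀ * product (map g ys)) × x₀ ∉ ys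
  product-isolate {xs = x ∷ xs} (x∉xs ∷ _) (here refl) =
    xs , (λ _ → refl) , λ x∈xs → All.lookup x∉xs x∈xs refl
  product-isolate {x₀ = x₀} {xs = x ∷ xs} (x∉xs ∷ u) (there x₀∈xs)
    with ys , eq , x₀∉ys ← product-isolate u x₀∈xs =
    x ∷ ys
    , (λ g → trans (cong (g x *_) (eq g)) (swap (g x) (g x₀) _))
    , λ { (here refl) → All.lookup x∉xs x₀∈xs refl ; (there p) → x₀∉ys p }
    where
    swap : ∀ a b c → a * (b * c) ≡ b * (a * c)
    swap = solve-∀

  concatMap-unique : {B : Set} (f : A → List B) {xs : List A} → Unique xs →
                     (∀ x → Unique (f x)) → (∀ {x y z} → z ∈ f x → z ∈ f y → x ≡ y) →
                     Unique (concatMap f xs)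
  concatMap-unique f []         uf disj = []
  concatMap-unique f (x∉xs ∷ u) uf disj =
    Unique.++⁺ (uf _) (concatMap-unique f u uf disj) λ (z∈fx , z∈rest) →
      let y , y∈xs , z∈fy = find (Membership.∈-concatMap⁻ f z∈rest)
      in All.lookup x∉xs y∈xs (disj z∈fx z∈fy)

  map-unique : {B : Set} (f : A → B) {xs : List A} → Unique xs →
               (∀ {x y} → x ∈ xs → y ∈ xs → f x ≡ f y → x ≡ y) → Unique (map f xs)
  map-unique f []         inj = []
  map-unique f (x∉xs ∷ u) inj =
    All.tabulate (λ fy∈ fx≡ →
      let y , y∈xs , eq = Membership.∈-map⁻ f fy∈
      in All.lookup x∉xs y∈xs (inj (here refl) (there y∈xs) (trans fx≡ eq)))
    ∷ map-unique f u (λ p q → inj (there p) (there q))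

-- A vertex chooses its parent by choosing a token of its label; `owner` tells
-- which vertex a token currently stands for, `nothing` being the root.

data Grounded {Tok : Set} {N : ℕ} (owner : Tok → Maybe (Fin N)) (f : Vec Tok N) : Fin N → Set where
  root : ∀ {i} → owner (lookup f i) ≡ nothing → Grounded owner f i
  via  : ∀ {i j} → owner (lookup f i) ≡ just j → Grounded owner f j → Grounded owner f i

-- Contraction of vertex zero into its parent `y`: the tokens of zero pass to `y`, and the other
-- vertices are renumbered.
redirect : ∀ {N} → Maybe (Fin N) → Maybe (Fin (suc N)) → Maybe (Fin N)
redirect y nothing        = nothing
redirect y (just zero)    = y
redirect y (just (suc j)) = just j

-- There is no constructor for `owner t ≡ just zero`: a loop at zero cannot be contracted.
data ParentOfZero {Tok : Set} {N : ℕ} (owner : Tok → Maybe (Fin (suc N))) (t : Tok) :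
                  Maybe (Fin N) → Set where
  root : owner t ≡ nothing → ParentOfZero owner t nothing
  via  : ∀ {j} → owner t ≡ just (suc j) → ParentOfZero owner t (just j)

module _ {Tok : Set} {N : ℕ} (owner : Tok → Maybe (Fin (suc N))) (t : Tok) (g : Vec Tok N) where

  -- A path to the root that visits zero continues to the owner of `t`, which is `y`; after
  -- contraction the token leading to zero leads to `y` at once, so the path merely loses one step.
  grounded-contract : ∀ {y} → ParentOfZero owner t y → ∀ {i} → Grounded owner (t ∷ g) (suc i) →
                      Grounded (redirect y ∘ owner) g i
  grounded-contract {y} p (root e)                           = root (cong (redirect y) e)
  grounded-contract {y} p (via {j = suc j} e h)              = via (cong (redirect y) e) (grounded-contract p h)
  grounded-contract (root _) (via {j = zero} e _)            = root (cong (redirect nothing) e)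
  grounded-contract (via e₁) (via {j = zero} e (root e₂))
    with () ← trans (≡-sym e₁) e₂
  grounded-contract p@(via {y} e₁) (via {j = zero} e (via e₂ h))
    with refl ← trans (≡-sym e₁) e₂ = via (cong (redirect (just y)) e) (grounded-contract p h)

  grounded-expand : ∀ {y} → ParentOfZero owner t y → ∀ {i} → Grounded (redirect y ∘ owner) g i →
                    Grounded owner (t ∷ g) (suc i)
  grounded-expand p {i} (root e) with owner (lookup g i) in eq
  grounded-expand p        (root e) | nothing     = root eq
  grounded-expand (root z) (root e) | just zero   = via eq (root z)
  grounded-expand p {i} (via e h) with owner (lookup g i) in eq
  grounded-expand p           (via refl h) | just (suc j) = via eq (grounded-expand p h)
  grounded-expand p@(via z)   (via refl h) | just zero    = via eq (via z (grounded-expand p h))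

  grounded-zero : ∀ {y} → ParentOfZero owner t y → (∀ i → Grounded owner (t ∷ g) (suc i)) →
                  Grounded owner (t ∷ g) zero
  grounded-zero (root e) h = root e
  grounded-zero (via e)  h = via e (h _)

grounded-irrefl : ∀ {Tok : Set} {N} {owner : Tok → Maybe (Fin N)} {f i} →
                  Grounded owner f i → owner (lookup f i) ≢ just i
grounded-irrefl (root e)  e′ with () ← trans (≡-sym e) e′
grounded-irrefl (via e h) e′ with refl ← trans (≡-sym e) e′ = grounded-irrefl h e

isRoot : ∀ {N} → Maybe (Fin N) → ℕ
isRoot nothing  = 1
isRoot (just _) = 0

isZero isSuc : ∀ {N} → Maybe (Fin (suc N)) → ℕ
isZero (just zero)    = 1
isZero _              = 0
isSuc  (just (suc _)) = 1
isSuc  _              = 0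

-- Counting forests with several labels of vertices

module Forests {L Tok : Set} (_≟_ : DecidableEquality L)
               (toks : L → List Tok) (toks-unique : ∀ ℓ → Unique (toks ℓ)) where

  -- Vertex zero chooses a token `t` of its label and is then contracted along it. `extend` receives
  -- `owner t` as an argument of its own so that lemmas can split on it.
  enum   : ∀ {N} → Vec L N → (Tok → Maybe (Fin N)) → List (Vec Tok N)
  extend : ∀ {N} → Vec L N → (Tok → Maybe (Fin (suc N))) → Tok → Maybe (Fin (suc N)) →
           List (Vec Tok (suc N))

  enum []      owner = [] ∷ []
  enum (ℓ ∷ c) owner = concatMap (λ t → extend c owner t (owner t)) (toks ℓ)

  extend c owner t nothing        = map (t ∷_) (enum c (redirect nothing ∘ owner))
  -- Zero would be its own parent and never reach the root.
  extend c owner t (just zero)    = []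
  extend c owner t (just (suc y)) = map (t ∷_) (enum c (redirect (just y) ∘ owner))

  Valid : ∀ {N} → Vec L N → (Tok → Maybe (Fin N)) → Vec Tok N → Set
  Valid c owner f = (∀ i → lookup f i ∈ toks (lookup c i)) × (∀ i → Grounded owner f i)

  ∈-enum⁻ : ∀ {N} (c : Vec L N) owner {f} → f ∈ enum c owner → Valid c owner f
  ∈-enum⁻ []      owner (here refl) = (λ ()) , (λ ())
  ∈-enum⁻ (ℓ ∷ c) owner {f} f∈
    with t , t∈ , f∈t ← find (Membership.∈-concatMap⁻ _ f∈) = go (owner t) refl f∈t
    where
    build : ∀ {t} → t ∈ toks ℓ → ∀ {y} → ParentOfZero owner t y →
            f ∈ map (t ∷_) (enum c (redirect y ∘ owner)) → Valid (ℓ ∷ c) owner f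
    build {t} t∈ p f∈t
      with g , g∈ , refl ← Membership.∈-map⁻ (t ∷_) f∈t
      with mem , grd ← ∈-enum⁻ c _ g∈ =
      let grd′ = λ i → grounded-expand owner t g p (grd i) in
      (λ { zero → t∈ ; (suc i) → mem i })
      , (λ { zero → grounded-zero owner t g p grd′ ; (suc i) → grd′ i })
    go : ∀ y → owner t ≡ y → f ∈ extend c owner t y → Valid (ℓ ∷ c) owner f
    go nothing        eq = build t∈ (root eq)
    go (just (suc _)) eq = build t∈ (via eq)

  ∈-enum⁺ : ∀ {N} (c : Vec L N) owner {f} → Valid c owner f → f ∈ enum c owner
  ∈-enum⁺ []      owner {[]}    _           = here refl
  ∈-enum⁺ (ℓ ∷ c) owner {t ∷ g} (mem , grd) =
    Membership.∈-concatMap⁺ _ (Any.map (λ { refl → go (owner t) refl }) (mem zero))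
    where
    build : ∀ {y} → ParentOfZero owner t y → (t ∷ g) ∈ map (t ∷_) (enum c (redirect y ∘ owner))
    build p = Membership.∈-map⁺ (t ∷_)
      (∈-enum⁺ c _ (mem ∘ suc , λ i → grounded-contract owner t g p (grd (suc i))))
    go : ∀ y → owner t ≡ y → (t ∷ g) ∈ extend c owner t y
    go nothing        eq = build (root eq)
    go (just zero)    eq = contradiction eq (grounded-irrefl (grd zero))
    go (just (suc _)) eq = build (via eq)

  extend-head : ∀ {N} (c : Vec L N) owner t y {f} → f ∈ extend c owner t y → lookup f zero ≡ t
  extend-head c owner t nothing        f∈ with _ , _ , refl ← Membership.∈-map⁻ (t ∷_) f∈ = refl
  extend-head c owner t (just (suc y)) f∈ with _ , _ , refl ← Membership.∈-map⁻ (t ∷_) f∈ = refl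

  enum-unique : ∀ {N} (c : Vec L N) owner → Unique (enum c owner)
  enum-unique []      owner = [] ∷ []
  enum-unique (ℓ ∷ c) owner =
    concatMap-unique (λ t → extend c owner t (owner t)) (toks-unique ℓ)
      (λ t → unique t (owner t))
      (λ {t} {u} p q → trans (≡-sym (extend-head c owner t (owner t) p)) (extend-head c owner u (owner u) q))
    where
    unique : ∀ t y → Unique (extend c owner t y)
    unique t nothing        = Unique.map⁺ Vec.∷-injectiveʳ (enum-unique c _)
    unique t (just zero)    = []
    unique t (just (suc y)) = Unique.map⁺ Vec.∷-injectiveʳ (enum-unique c _)

  mult : ∀ {N} → L → Vec L N → ℕ
  mult ℓ []      = 0
  mult ℓ (x ∷ c) = (if does (x ≟ ℓ) then 1 else 0) + mult ℓ c

  W : L → ℕ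
  W ℓ = length (toks ℓ)

  rootToks : ∀ {N} → (Tok → Maybe (Fin N)) → L → ℕ
  rootToks owner ℓ = sum (map (isRoot ∘ owner) (toks ℓ))

  -- The invariant that keeps the labels independent: contracting a vertex of one label leaves the
  -- number of root tokens of every other label unchanged.
  Compatible : ∀ {N} → Vec L N → (Tok → Maybe (Fin N)) → Set
  Compatible c owner = ∀ ℓ t → t ∈ toks ℓ → ∀ j → owner t ≡ just j → lookup c j ≡ ℓ

  redirect-compatible : ∀ {N} {ℓ₀} {c : Vec L N} {owner} → Compatible (ℓ₀ ∷ c) owner →
                        ∀ {y} → (∀ j → y ≡ just j → lookup c j ≡ ℓ₀) →
                        Compatible c (redirect y ∘ owner)
  redirect-compatible {owner = owner} comp hy ℓ t t∈ j e with owner t in eq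
  redirect-compatible comp hy ℓ t t∈ j refl | just (suc .j) = comp ℓ t t∈ (suc j) eq
  redirect-compatible comp hy ℓ t t∈ j e    | just zero     = trans (hy j e) (comp ℓ t t∈ zero eq)

  -- This is r W^M, which is W times the number r W^(M-1) of forests on the M vertices of label `ℓ`.
  -- The extra factor avoids the exponent M - 1, which is negative for a label without vertices.
  forestCount : ∀ {N} (c : Vec L N) (owner : Tok → Maybe (Fin N)) → L → ℕ
  forestCount c owner ℓ = rootToks owner ℓ * W ℓ ^ mult ℓ c

  rootToks-redirect-other : ∀ {N} {ℓ₀} {c : Vec L N} {owner} → Compatible (ℓ₀ ∷ c) owner →
                            ∀ y {ℓ} → ℓ ≢ ℓ₀ → rootToks (redirect y ∘ owner) ℓ ≡ rootToks owner ℓ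
  rootToks-redirect-other {owner = owner} comp y {ℓ} ℓ≢ = cong sum (map-cong-∈ same)
    where
    same : ∀ t → t ∈ toks ℓ → isRoot (redirect y (owner t)) ≡ isRoot (owner t)
    same t t∈ with owner t in eq
    ... | nothing      = refl
    ... | just (suc _) = refl
    ... | just zero    = contradiction (≡-sym (comp ℓ t t∈ zero eq)) ℓ≢

  rootToks-redirect-nothing : ∀ {N} (owner : Tok → Maybe (Fin (suc N))) ℓ →
    rootToks (redirect nothing ∘ owner) ℓ ≡ rootToks owner ℓ + sum (map (isZero ∘ owner) (toks ℓ))
  rootToks-redirect-nothing owner ℓ =
    trans (cong sum (List.map-cong (λ t → same (owner t)) (toks ℓ))) (sum-map-+ _ _ (toks ℓ))
    where
    same : ∀ y → isRoot (redirect nothing y) ≡ isRoot y + isZero y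
    same nothing        = refl
    same (just zero)    = refl
    same (just (suc _)) = refl

  rootToks-redirect-just : ∀ {N} (owner : Tok → Maybe (Fin (suc N))) y ℓ →
    rootToks (redirect (just y) ∘ owner) ℓ ≡ rootToks owner ℓ
  rootToks-redirect-just owner y ℓ = cong sum (List.map-cong (λ t → same (owner t)) (toks ℓ))
    where
    same : ∀ z → isRoot (redirect (just y) z) ≡ isRoot z
    same nothing        = refl
    same (just zero)    = refl
    same (just (suc _)) = refl

  mult-head : ∀ {N} ℓ (c : Vec L N) → mult ℓ (ℓ ∷ c) ≡ suc (mult ℓ c)
  mult-head ℓ c with ℓ ≟ ℓ
  ... | yes _ = refl
  ... | no ¬p = contradiction refl ¬p

  mult-tail : ∀ {N} {ℓ ℓ₀} (c : Vec L N) → ℓ ≢ ℓ₀ → mult ℓ (ℓ₀ ∷ c) ≡ mult ℓ c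
  mult-tail {ℓ = ℓ} {ℓ₀} c ℓ≢ with ℓ₀ ≟ ℓ
  ... | yes p = contradiction (≡-sym p) ℓ≢
  ... | no _  = refl

  -- Contracting vertex zero into its parent keeps W.  Of the W = r + z + s tokens
  -- it may choose, the r root ones raise the number r of root tokens to r + z, the
  -- z it owns are forbidden and the s others keep r: r (r + z) + s r = r W.
  length-enum : ∀ {N} (Λ : List L) → Unique Λ → (c : Vec L N) → (∀ i → lookup c i ∈ Λ) →
                ∀ owner → Compatible c owner →
                length (enum c owner) * product (map W Λ) ≡ product (map (forestCount c owner) Λ)
  -- No vertex is left to own a token, so all tokens are root tokens and r = W for each label.
  length-enum Λ uΛ [] c∈ owner comp =
    trans (ℕ.+-identityʳ _) (cong product (List.map-cong same Λ))
    where
    isRoot-Fin0 : (y : Maybe (Fin 0)) → isRoot y ≡ 1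
    isRoot-Fin0 nothing = refl
    same : ∀ ℓ → W ℓ ≡ rootToks owner ℓ * 1
    same ℓ = ≡-sym (trans (ℕ.*-identityʳ _)
      (trans (cong sum (List.map-cong (isRoot-Fin0 ∘ owner) (toks ℓ))) (sum-map-1 (toks ℓ))))
  length-enum {suc N} Λ uΛ (ℓ₀ ∷ c) c∈ owner comp
    with Λ′ , split , ℓ₀∉Λ′ ← product-isolate uΛ (c∈ zero) = begin
    length (enum (ℓ₀ ∷ c) owner) * PW                       ≡⟨ cong (_* PW) (length-concatMap _ (toks ℓ₀)) ⟩
    sum (map (λ t → length (ext t)) (toks ℓ₀)) * PW         ≡⟨ sum-map-*ʳ (length ∘ ext) PW (toks ℓ₀) ⟨
    sum (map (λ t → length (ext t) * PW) (toks ℓ₀))         ≡⟨ cong sum (map-cong-∈ (λ t t∈ → each t (owner t) t∈ refl)) ⟩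
    sum (map (λ t → gain (owner t) * (w ^ M * R)) (toks ℓ₀)) ≡⟨ sum-map-*ʳ (gain ∘ owner) _ (toks ℓ₀) ⟩
    sum (map (gain ∘ owner) (toks ℓ₀)) * (w ^ M * R)        ≡⟨ cong (_* (w ^ M * R)) total ⟩
    (r * (r + z) + s * r) * (w ^ M * R)                     ≡⟨ arith r z s (w ^ M) R ⟩
    r * ((r + z + s) * w ^ M) * R                           ≡⟨ cong (λ x → r * (x * w ^ M) * R) w-split ⟨
    r * (w ^ suc M) * R                                     ≡⟨ cong (λ x → r * (w ^ x) * R) (mult-head ℓ₀ c) ⟨
    forestCount (ℓ₀ ∷ c) owner ℓ₀ * R                       ≡⟨ split (forestCount (ℓ₀ ∷ c) owner) ⟨
    product (map (forestCount (ℓ₀ ∷ c) owner) Λ)            ∎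
    where
    open ≡-Reasoning
    PW = product (map W Λ)
    ext = λ t → extend c owner t (owner t)
    w = W ℓ₀
    M = mult ℓ₀ c
    r = rootToks owner ℓ₀
    z = sum (map (isZero ∘ owner) (toks ℓ₀))
    s = sum (map (isSuc ∘ owner) (toks ℓ₀))
    R = product (map (forestCount (ℓ₀ ∷ c) owner) Λ′)
    gain : Maybe (Fin (suc N)) → ℕ
    gain y = isRoot y * (r + z) + isSuc y * r

    total : sum (map (gain ∘ owner) (toks ℓ₀)) ≡ r * (r + z) + s * r
    total = trans (sum-map-+ _ _ (toks ℓ₀))
      (cong₂ _+_ (sum-map-*ʳ (isRoot ∘ owner) _ (toks ℓ₀)) (sum-map-*ʳ (isSuc ∘ owner) _ (toks ℓ₀)))

    w-split : w ≡ r + z + s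
    w-split = begin
      w                                                             ≡⟨ sum-map-1 (toks ℓ₀) ⟨
      sum (map (λ _ → 1) (toks ℓ₀))                                 ≡⟨ cong sum (List.map-cong (λ t → one (owner t)) (toks ℓ₀)) ⟩
      sum (map (λ t → isRoot (owner t) + isZero (owner t) + isSuc (owner t)) (toks ℓ₀)) ≡⟨ sum-map-+ _ _ (toks ℓ₀) ⟩
      _                                                             ≡⟨ cong (_+ s) (sum-map-+ _ _ (toks ℓ₀)) ⟩
      r + z + s                                                     ∎
      where
      one : (y : Maybe (Fin (suc N))) → 1 ≡ isRoot y + isZero y + isSuc y
      one nothing        = refl
      one (just zero)    = refl
      one (just (suc _)) = refl

    arith : ∀ r z s p R → (r * (r + z) + s * r) * (p * R) ≡ r * ((r + z + s) * p) * R
    arith = solve-∀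

    contracted : ∀ t y → (∀ j → y ≡ just j → lookup c j ≡ ℓ₀) →
                 length (map (t ∷_) (enum c (redirect y ∘ owner))) * PW
                 ≡ rootToks (redirect y ∘ owner) ℓ₀ * (w ^ M * R)
    contracted t y hy = begin
      length (map (t ∷_) (enum c owner′)) * PW ≡⟨ cong (_* PW) (List.length-map (t ∷_) (enum c owner′)) ⟩
      length (enum c owner′) * PW              ≡⟨ length-enum Λ uΛ c (c∈ ∘ suc) owner′ (redirect-compatible comp hy) ⟩
      product (map (forestCount c owner′) Λ)   ≡⟨ split (forestCount c owner′) ⟩
      forestCount c owner′ ℓ₀ * product (map (forestCount c owner′) Λ′)
        ≡⟨ cong (λ x → forestCount c owner′ ℓ₀ * product x) (map-cong-∈ other) ⟩
      forestCount c owner′ ℓ₀ * R              ≡⟨ ℕ.*-assoc (rootToks owner′ ℓ₀) (w ^ M) R ⟩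
      rootToks owner′ ℓ₀ * (w ^ M * R)         ∎
      where
      owner′ = redirect y ∘ owner
      other : ∀ ℓ → ℓ ∈ Λ′ → forestCount c owner′ ℓ ≡ forestCount (ℓ₀ ∷ c) owner ℓ
      other ℓ ℓ∈ = cong₂ (λ a b → a * W ℓ ^ b)
        (rootToks-redirect-other comp y ℓ≢) (≡-sym (mult-tail c ℓ≢))
        where
        ℓ≢ : ℓ ≢ ℓ₀
        ℓ≢ refl = ℓ₀∉Λ′ ℓ∈

    each : ∀ t y → t ∈ toks ℓ₀ → owner t ≡ y →
           length (extend c owner t y) * PW ≡ gain y * (w ^ M * R)
    each t nothing        t∈ eq = trans (contracted t nothing (λ _ ()))
      (cong (_* (w ^ M * R)) (trans (rootToks-redirect-nothing owner ℓ₀) (pad (r + z))))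
      where
      pad : ∀ a → a ≡ 1 * a + 0
      pad = solve-∀
    each t (just zero)    t∈ eq = refl
    each t (just (suc y)) t∈ eq =
      trans (contracted t (just y) (λ { _ refl → comp ℓ₀ t t∈ (suc y) eq }))
        (cong (_* (w ^ M * R)) (trans (rootToks-redirect-just owner y ℓ₀) (≡-sym (ℕ.*-identityˡ r))))

-- The case of one root token and one token for each vertex

module LabelledForests {L : Set} (_≟_ : DecidableEquality L) {N : ℕ} (c : Vec L N) where

  classmates : L → List (Fin N)
  classmates ℓ = filter (λ j → lookup c j ≟ ℓ) (allFin N)

  -- The vertex itself is among its options, so the list depends on the label alone; choosing itself
  -- is excluded by `Grounded`.
  parents : L → List (Maybe (Fin N))
  parents ℓ = nothing ∷ map just (classmates ℓ)

  parents-unique : ∀ ℓ → Unique (parents ℓ)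
  parents-unique ℓ =
    All.tabulate (λ p → λ { refl → case-∅ (Membership.∈-map⁻ just p) })
    ∷ Unique.map⁺ Maybe.just-injective (Unique.filter⁺ _ (Unique.allFin⁺ N))
    where
    case-∅ : ¬ ∃ λ j → j ∈ classmates ℓ × nothing ≡ just j
    case-∅ (_ , _ , ())

  open Forests _≟_ parents parents-unique public

  forests : List (Vec (Maybe (Fin N)) N)
  forests = enum c id

  just-∈-parents⁻ : ∀ {ℓ j} → just j ∈ parents ℓ → lookup c j ≡ ℓ
  just-∈-parents⁻ {ℓ} (there p) with _ , j∈ , refl ← Membership.∈-map⁻ just p =
    proj₂ (Membership.∈-filter⁻ (λ j → lookup c j ≟ ℓ) {xs = allFin N} j∈)

  just-∈-parents⁺ : ∀ {ℓ j} → lookup c j ≡ ℓ → just j ∈ parents ℓ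
  just-∈-parents⁺ {ℓ} {j} e =
    there (Membership.∈-map⁺ just (Membership.∈-filter⁺ (λ j → lookup c j ≟ ℓ) (Membership.∈-allFin j) e))

  -- The map `g` is there for the induction: `allFin N` is a tabulation of `id`, and its tails are
  -- tabulations of shifted maps.
  length-classmates : ∀ {M} (d : Vec L M) ℓ (g : Fin M → Fin N) → (∀ i → lookup d i ≡ lookup c (g i)) →
                      length (filter (λ j → lookup c j ≟ ℓ) (tabulateL g)) ≡ mult ℓ d
  length-classmates []      ℓ g eq = refl
  length-classmates (x ∷ d) ℓ g eq with eq zero
  ... | refl with lookup c (g zero) ≟ ℓ
  ... | yes _ = cong suc (length-classmates d ℓ (g ∘ suc) (eq ∘ suc))
  ... | no _  = length-classmates d ℓ (g ∘ suc) (eq ∘ suc)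

  W≡1+mult : ∀ ℓ → W ℓ ≡ mult ℓ c + 1
  W≡1+mult ℓ = trans (cong suc (trans (List.length-map just (classmates ℓ))
    (length-classmates c ℓ id (λ _ → refl)))) (ℕ.+-comm 1 _)

  rootToks≡1 : ∀ ℓ → rootToks id ℓ ≡ 1
  rootToks≡1 ℓ = cong suc (none (classmates ℓ))
    where
    none : ∀ js → sum (map isRoot (map just js)) ≡ 0
    none []       = refl
    none (_ ∷ js) = none js

  -- The left side is r W^M with r = 1, M = a and W = a + 1. The truncated exponent is harmless at a
  -- = 0, where the base is 1.
  power-split : ∀ a → 1 * (a + 1) ^ a ≡ (a + 1) ^ (a ∸ 1) * (a + 1)
  power-split zero    = refl
  power-split (suc a) = trans (ℕ.*-identityˡ _) (ℕ.*-comm (suc a + 1) _)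

  length-forests : ∀ Λ → Unique Λ → (∀ i → lookup c i ∈ Λ) →
                   length forests ≡ product (map (λ ℓ → (mult ℓ c + 1) ^ (mult ℓ c ∸ 1)) Λ)
  length-forests Λ uΛ c∈ = ℕ.*-cancelʳ-≡ _ _ (product (map W Λ)) {{W≢0 Λ}} (begin
    length forests * product (map W Λ)               ≡⟨ length-enum Λ uΛ c c∈ id compatible ⟩
    product (map (forestCount c id) Λ)               ≡⟨ cong product (List.map-cong factor Λ) ⟩
    product (map (λ ℓ → F ℓ * W ℓ) Λ)                ≡⟨ product-map-* F W Λ ⟩
    product (map F Λ) * product (map W Λ)            ∎)
    where
    open ≡-Reasoning
    F : L → ℕ
    F ℓ = (mult ℓ c + 1) ^ (mult ℓ c ∸ 1)
    -- The root token is always present, so `W ℓ` computes to a successor.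
    W≢0 : ∀ Λ → NonZero (product (map W Λ))
    W≢0 []      = _
    W≢0 (ℓ ∷ Λ) = ℕ.m*n≢0 (W ℓ) _ {{_}} {{W≢0 Λ}}
    compatible : Compatible c id
    compatible ℓ _ t∈ j refl = just-∈-parents⁻ t∈
    factor : ∀ ℓ → forestCount c id ℓ ≡ F ℓ * W ℓ
    factor ℓ = trans (cong₂ (λ a b → a * b ^ mult ℓ c) (rootToks≡1 ℓ) (W≡1+mult ℓ))
      (trans (power-split (mult ℓ c)) (cong (F ℓ *_) (≡-sym (W≡1+mult ℓ))))

-- Rooted trees

∑-suc : ∀ {m} (f : Fin (suc m) → ℕ) → ∑ f ≡ f zero + ∑ (f ∘ suc)
∑-suc f = cong (λ xs → f zero + sum xs)
  (trans (List.map-tabulate suc f) (≡-sym (List.map-tabulate id (f ∘ suc))))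

∑-cong : ∀ {m} {f g : Fin m → ℕ} → f ≗ g → ∑ f ≡ ∑ g
∑-cong {m} f≗g = cong sum (List.map-cong f≗g (allFin m))

∑-distrib-+ : ∀ {m} (f g : Fin m → ℕ) → ∑ (λ i → f i + g i) ≡ ∑ f + ∑ g
∑-distrib-+ {m} f g = sum-map-+ f g (allFin m)

∑-0 : ∀ m → ∑ {m} (λ _ → 0) ≡ 0
∑-0 zero    = refl
∑-0 (suc m) = trans (∑-suc {m} (λ _ → 0)) (∑-0 m)

∑-1 : ∀ m → ∑ {m} (λ _ → 1) ≡ m
∑-1 m = trans (sum-map-1 (allFin m)) (List.length-tabulate {n = m} id)

∑-swap : ∀ {m n} (f : Fin m → Fin n → ℕ) → ∑ (λ i → ∑ (f i)) ≡ ∑ (λ j → ∑ λ i → f i j)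
∑-swap {zero}  {n} f = ≡-sym (∑-0 n)
∑-swap {suc m} {n} f = begin
  ∑ (λ i → ∑ (f i))                             ≡⟨ ∑-suc (λ i → ∑ (f i)) ⟩
  ∑ (f zero) + ∑ (λ i → ∑ (f (suc i)))          ≡⟨ cong (∑ (f zero) +_) (∑-swap (f ∘ suc)) ⟩
  ∑ (f zero) + ∑ (λ j → ∑ λ i → f (suc i) j)    ≡⟨ ∑-distrib-+ (f zero) _ ⟨
  ∑ (λ j → f zero j + ∑ λ i → f (suc i) j)      ≡⟨ ∑-cong (λ j → ∑-suc (λ i → f i j)) ⟨
  ∑ (λ j → ∑ λ i → f i j)                       ∎
  where open ≡-Reasoning

∑-mono-≤ : ∀ {m} {f g : Fin m → ℕ} → (∀ i → f i ≤ g i) → ∑ f ≤ ∑ g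
∑-mono-≤ {zero}          f≤g = z≤n
∑-mono-≤ {suc m} {f} {g} f≤g rewrite ∑-suc f | ∑-suc g = ℕ.+-mono-≤ (f≤g zero) (∑-mono-≤ (f≤g ∘ suc))

-- No term can make up for a loss in another. This turns extremal counts into structure: a subgraph
-- with as many edges as the whole graph is the whole graph, and a tree reaching the bound on the
-- weight reaches it on every edge.
∑-tight : ∀ {m} {f g : Fin m → ℕ} → (∀ i → f i ≤ g i) → ∑ g ≤ ∑ f → ∀ i → f i ≡ g i
∑-tight {suc m} {f} {g} f≤g Σg≤Σf rewrite ∑-suc f | ∑-suc g = λ
  { zero    → ℕ.≤-antisym (f≤g zero)
      (ℕ.+-cancelʳ-≤ _ _ _ (ℕ.≤-trans Σg≤Σf (ℕ.+-monoʳ-≤ (f zero) tail≤)))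
  ; (suc i) → ∑-tight (f≤g ∘ suc)
      (ℕ.+-cancelˡ-≤ (g zero) _ _ (ℕ.≤-trans Σg≤Σf (ℕ.+-monoˡ-≤ _ (f≤g zero)))) i }
  where
  tail≤ : ∑ (f ∘ suc) ≤ ∑ (g ∘ suc)
  tail≤ = ∑-mono-≤ (f≤g ∘ suc)

∑-single : ∀ {m} (i : Fin m) (g : Fin m → ℕ) → ∑ (λ j → if does (i Fin.≟ j) then g j else 0) ≡ g i
∑-single {suc m} zero    g =
  trans (∑-suc (λ j → if does (zero Fin.≟ j) then g j else 0))
    (trans (cong (g zero +_) (∑-0 m)) (ℕ.+-identityʳ _))
∑-single {suc m} (suc i) g =
  trans (∑-suc (λ j → if does (suc i Fin.≟ j) then g j else 0)) (∑-single i (g ∘ suc))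

EdgeSet-ext : ∀ {m} {E E′ : EdgeSet m} → (∀ i j → E ⟨ i , j ⟩ ≡ E′ ⟨ i , j ⟩) → E ≡ E′
EdgeSet-ext eq = vec-ext (λ i → vec-ext (eq i))
  where
  vec-ext : ∀ {A : Set} {m} {xs ys : Vec A m} → (∀ i → lookup xs i ≡ lookup ys i) → xs ≡ ys
  vec-ext {xs = xs} {ys} e =
    trans (≡-sym (Vec.tabulate∘lookup xs)) (trans (Vec.tabulate-cong e) (Vec.tabulate∘lookup ys))

<ᵇ-flip : ∀ m n → m ≢ n → (m <ᵇ n) ≡ not (n <ᵇ m)
<ᵇ-flip zero    zero    m≢n = contradiction refl m≢n
<ᵇ-flip zero    (suc n) m≢n = refl
<ᵇ-flip (suc m) zero    m≢n = refl
<ᵇ-flip (suc m) (suc n) m≢n = <ᵇ-flip m n (m≢n ∘ cong suc)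

T⇒true : ∀ {b} → T b → b ≡ true
T⇒true = Equivalence.to T-≡

true⇒T : ∀ {b} → b ≡ true → T b
true⇒T = Equivalence.from T-≡

-- Trees given by parent functions

module RootedTree {m : ℕ} (ρ : Fin m) where

  -- Iterating `p` from the last index leads to `i`. No step starts at `ρ`, so `p ρ` is a dummy
  -- value, and parent functions are compared off `ρ` only.
  data Above (p : Fin m → Fin m) (i : Fin m) : Fin m → Set where
    here : Above p i i
    up   : ∀ {x} → x ≢ ρ → Above p i (p x) → Above p i x

  Rooted : (Fin m → Fin m) → Set
  Rooted p = ∀ i → Above p ρ i

  above-trans : ∀ {p i j x} → Above p i j → Above p j x → Above p i x
  above-trans ij here       = ij
  above-trans ij (up x≢ jx) = up x≢ (above-trans ij jx)

  -- A cycle through `i` can be rotated to start at `p i`, which is one step closer to `ρ`; the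
  -- induction ends at `ρ`, which no step leaves.
  no-cycle : ∀ {p i} → Above p ρ i → i ≢ ρ → ¬ Above p i (p i)
  no-cycle here            i≢ cyc = i≢ refl
  no-cycle {p} {i} (up _ h) i≢ cyc = no-cycle h (next≢ cyc) (rotate refl cyc)
    where
    next≢ : ∀ {x} → Above p i x → x ≢ ρ
    next≢ here      = i≢
    next≢ (up x≢ _) = x≢
    rotate : ∀ {x} → x ≡ p i → Above p i x → Above p x (p x)
    rotate e    here         = cyc
    rotate refl (up x≢ rest) = above-trans (up i≢ here) rest

  no-2-cycle : ∀ {p} → Rooted p → ∀ {i j} → i ≢ ρ → j ≢ ρ → p i ≡ j → p j ≢ i
  no-2-cycle rooted {i} i≢ j≢ refl ppi≡i =
    no-cycle (rooted i) i≢ (up j≢ (subst (Above _ i) (≡-sym ppi≡i) here))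

  parent≢ : ∀ {p} → Rooted p → ∀ {i} → i ≢ ρ → p i ≢ i
  parent≢ rooted {i} i≢ pi≡i = no-2-cycle rooted i≢ i≢ pi≡i pi≡i

  uplink : (Fin m → Fin m) → Fin m → Fin m → Bool
  uplink p i j = not (does (i Fin.≟ ρ)) ∧ does (p i Fin.≟ j)

  uplink⁻ : ∀ p {i j} → T (uplink p i j) → i ≢ ρ × p i ≡ j
  uplink⁻ p {i} {j} t with i Fin.≟ ρ | p i Fin.≟ j
  ... | no i≢ | yes e = i≢ , e

  uplink⁺ : ∀ p {i j} → i ≢ ρ → p i ≡ j → T (uplink p i j)
  uplink⁺ p {i} {j} i≢ e with i Fin.≟ ρ | p i Fin.≟ j
  ... | yes i≡ | _     = i≢ i≡
  ... | no _   | yes _ = _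
  ... | no _   | no ¬e = ¬e e

  treeOf : (Fin m → Fin m) → EdgeSet m
  treeOf p = tabulate λ i → tabulate λ j → uplink p i j ∨ uplink p j i

  treeOf-lookup : ∀ p i j → treeOf p ⟨ i , j ⟩ ≡ uplink p i j ∨ uplink p j i
  treeOf-lookup p i j = trans
    (cong (λ row → lookup row j) (Vec.lookup∘tabulate (λ i → tabulate λ j → uplink p i j ∨ uplink p j i) i))
    (Vec.lookup∘tabulate _ j)

  treeOf-edge⁻ : ∀ p {i j} → T (treeOf p ⟨ i , j ⟩) → (i ≢ ρ × p i ≡ j) ⊎ (j ≢ ρ × p j ≡ i)
  treeOf-edge⁻ p {i} {j} t with Equivalence.to T-∨ (subst T (treeOf-lookup p i j) t)
  ... | inj₁ u = inj₁ (uplink⁻ p u)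
  ... | inj₂ u = inj₂ (uplink⁻ p u)

  treeOf-sym : ∀ p i j → treeOf p ⟨ i , j ⟩ ≡ treeOf p ⟨ j , i ⟩
  treeOf-sym p i j = trans (treeOf-lookup p i j)
    (trans (∨-comm (uplink p i j) _) (≡-sym (treeOf-lookup p j i)))

  treeOf-edge⁺ : ∀ p {i} → i ≢ ρ → T (treeOf p ⟨ i , p i ⟩)
  treeOf-edge⁺ p {i} i≢ =
    subst T (≡-sym (treeOf-lookup p i (p i))) (Equivalence.from T-∨ (inj₁ (uplink⁺ p i≢ refl)))

  treeOf-irrefl : ∀ {p} → Rooted p → ∀ i → treeOf p ⟨ i , i ⟩ ≡ false
  treeOf-irrefl {p} rooted i with treeOf p ⟨ i , i ⟩ in eq
  ... | false = refl
  ... | true with treeOf-edge⁻ p (true⇒T eq)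
  ...   | inj₁ (i≢ , e) = contradiction e (parent≢ rooted i≢)
  ...   | inj₂ (i≢ , e) = contradiction e (parent≢ rooted i≢)

  treeOf-connected : ∀ {p} → Rooted p → ∀ i j → Walk (_⟨_,_⟩ (treeOf p)) ∅ i j
  treeOf-connected {p} rooted i j = ascend (rooted i) (descend (rooted j) (here Subset.∉⊥))
    where
    ascend : ∀ {x y} → Above p ρ x → Walk (_⟨_,_⟩ (treeOf p)) ∅ ρ y → Walk (_⟨_,_⟩ (treeOf p)) ∅ x y
    ascend here      w = w
    ascend (up x≢ h) w = there Subset.∉⊥ (treeOf-edge⁺ p x≢) (ascend h w)
    descend : ∀ {x y} → Above p ρ x → Walk (_⟨_,_⟩ (treeOf p)) ∅ x y → Walk (_⟨_,_⟩ (treeOf p)) ∅ ρ y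
    descend here          w = w
    descend (up {x} x≢ h) w =
      descend h (there Subset.∉⊥ (subst T (treeOf-sym p x (p x)) (treeOf-edge⁺ p x≢)) w)

  -- Induction along the path of `q` to the root. The edge between `i` and `q i` belongs to the tree
  -- of `p`, so either `p i` is `q i` or `p (q i)` is `i`; in the latter case the induction
  -- hypothesis at `q i` makes `i` and `q i` a 2-cycle of `q`.
  treeOf-injective : ∀ {p q} → Rooted q → treeOf p ≡ treeOf q → ∀ {i} → i ≢ ρ → p i ≡ q i
  treeOf-injective {p} {q} rooted eq {i} i≢ = agree (rooted i) i≢
    where
    agree : ∀ {i} → Above q ρ i → i ≢ ρ → p i ≡ q i
    agree here i≢ = contradiction refl i≢
    agree {i} (up _ h) i≢
      with treeOf-edge⁻ p {i} {q i} (subst (λ E → T (E ⟨ i , q i ⟩)) (≡-sym eq) (treeOf-edge⁺ q i≢))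
    ... | inj₁ (_ , e)  = e
    ... | inj₂ (j≢ , e) = contradiction (trans (≡-sym (agree h j≢)) e) (no-2-cycle rooted i≢ j≢ refl)

  sumBelowRoot : (Fin m → ℕ) → ℕ
  sumBelowRoot h = ∑ λ i → if does (i Fin.≟ ρ) then 0 else h i

  sumBelowRoot-cong : ∀ {h g} → (∀ i → i ≢ ρ → h i ≡ g i) → sumBelowRoot h ≡ sumBelowRoot g
  sumBelowRoot-cong {h} {g} eq = ∑-cong same
    where
    same : ∀ i → (if does (i Fin.≟ ρ) then 0 else h i) ≡ (if does (i Fin.≟ ρ) then 0 else g i)
    same i with i Fin.≟ ρ
    ... | yes _ = refl
    ... | no i≢ = eq i i≢

  private
    below-≤ : ∀ {h g : Fin m → ℕ} → (∀ i → i ≢ ρ → h i ≤ g i) →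
              ∀ i → (if does (i Fin.≟ ρ) then 0 else h i) ≤ (if does (i Fin.≟ ρ) then 0 else g i)
    below-≤ le i with i Fin.≟ ρ
    ... | yes _ = z≤n
    ... | no i≢ = le i i≢

  sumBelowRoot-mono-≤ : ∀ {h g} → (∀ i → i ≢ ρ → h i ≤ g i) → sumBelowRoot h ≤ sumBelowRoot g
  sumBelowRoot-mono-≤ {h} {g} le = ∑-mono-≤ (below-≤ {h} {g} le)

  sumBelowRoot-tight : ∀ {h g} → (∀ i → i ≢ ρ → h i ≤ g i) → sumBelowRoot g ≤ sumBelowRoot h →
                       ∀ i → i ≢ ρ → h i ≡ g i
  sumBelowRoot-tight {h} {g} le ge i i≢ with ∑-tight (below-≤ {h} {g} le) ge i
  ... | eq with i Fin.≟ ρ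
  ...   | yes i≡ = contradiction i≡ i≢
  ...   | no _   = eq

  treeOf-cong : ∀ {p q} → (∀ i → i ≢ ρ → p i ≡ q i) → treeOf p ≡ treeOf q
  treeOf-cong {p} {q} eq = Vec.tabulate-cong λ i → Vec.tabulate-cong λ j → cong₂ _∨_ (same i j) (same j i)
    where
    same : ∀ i j → uplink p i j ≡ uplink q i j
    same i j with i Fin.≟ ρ
    ... | yes _ = refl
    ... | no i≢ rewrite eq i i≢ = refl

  -- An edge is counted at its end of smaller index, which may be the child (`asc`) or the parent
  -- (`desc`). Exchanging the order of summation in the second case moves every edge to its child.
  -- `Rooted` excludes loops and edges whose two ends are each the parent of the other.
  edgeSum-treeOf : ∀ {p} → Rooted p → (f : Fin m → Fin m → ℕ) → (∀ i j → f i j ≡ f j i) →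
                   edgeSum (treeOf p) f ≡ sumBelowRoot (λ i → f i (p i))
  edgeSum-treeOf {p} rooted f f-sym = begin
    edgeSum (treeOf p) f
      ≡⟨ ∑-cong (λ i → ∑-cong (λ j → both i j)) ⟩
    ∑ (λ i → ∑ λ j → asc i j + desc j i)
      ≡⟨ ∑-cong (λ i → ∑-distrib-+ (asc i) (λ j → desc j i)) ⟩
    ∑ (λ i → ∑ (asc i) + ∑ λ j → desc j i)
      ≡⟨ ∑-distrib-+ (λ i → ∑ (asc i)) (λ i → ∑ λ j → desc j i) ⟩
    ∑ (λ i → ∑ (asc i)) + ∑ (λ i → ∑ λ j → desc j i)
      ≡⟨ cong (∑ (λ i → ∑ (asc i)) +_) (∑-swap (λ i j → desc j i)) ⟩
    ∑ (λ i → ∑ (asc i)) + ∑ (λ i → ∑ (desc i))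
      ≡⟨ ∑-distrib-+ (λ i → ∑ (asc i)) (λ i → ∑ (desc i)) ⟨
    ∑ (λ i → ∑ (asc i) + ∑ (desc i))
      ≡⟨ ∑-cong (λ i → ∑-distrib-+ (asc i) (desc i)) ⟨
    ∑ (λ i → ∑ λ j → asc i j + desc i j)
      ≡⟨ ∑-cong (λ i → trans (∑-cong (orient i)) (out i)) ⟩
    sumBelowRoot (λ i → f i (p i)) ∎
    where
    open ≡-Reasoning
    asc desc : Fin m → Fin m → ℕ
    asc  i j = if (toℕ i <ᵇ toℕ j) ∧ uplink p i j then f i j else 0
    desc i j = if (toℕ j <ᵇ toℕ i) ∧ uplink p i j then f i j else 0

    both : ∀ i j → (if (toℕ i <ᵇ toℕ j) ∧ treeOf p ⟨ i , j ⟩ then f i j else 0) ≡ asc i j + desc j i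
    both i j rewrite treeOf-lookup p i j | f-sym j i
      with toℕ i <ᵇ toℕ j | uplink p i j in e₁ | uplink p j i in e₂
    ... | false | _     | _     = refl
    ... | true  | true  | false = ≡-sym (ℕ.+-identityʳ _)
    ... | true  | false | true  = refl
    ... | true  | false | false = refl
    ... | true  | true  | true  =
      let (i≢ , pi≡j) = uplink⁻ p (true⇒T e₁)
          (j≢ , pj≡i) = uplink⁻ p (true⇒T e₂)
      in contradiction pj≡i (no-2-cycle rooted i≢ j≢ pi≡j)

    orient : ∀ i j → asc i j + desc i j ≡ (if uplink p i j then f i j else 0)
    orient i j with uplink p i j in e
    ... | false with toℕ i <ᵇ toℕ j | toℕ j <ᵇ toℕ i
    ...   | false | false = refl
    ...   | false | true  = refl
    ...   | true  | false = refl
    ...   | true  | true  = refl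
    orient i j | true = split (toℕ i <ᵇ toℕ j) (toℕ j <ᵇ toℕ i) (<ᵇ-flip (toℕ i) (toℕ j) i≢j)
      where
      i≢j : toℕ i ≢ toℕ j
      i≢j i≡j with refl ← Fin.toℕ-injective i≡j =
        let (i≢ , pi≡i) = uplink⁻ p (true⇒T e) in parent≢ rooted i≢ pi≡i
      split : ∀ a b → a ≡ not b → (if a ∧ true then f i j else 0) + (if b ∧ true then f i j else 0) ≡ f i j
      split true  false _ = ℕ.+-identityʳ _
      split false true  _ = refl

    out : ∀ i → ∑ (λ j → if uplink p i j then f i j else 0)
              ≡ (if does (i Fin.≟ ρ) then 0 else f i (p i))
    out i with does (i Fin.≟ ρ)
    ... | true  = ∑-0 m
    ... | false = ∑-single (p i) (f i)

  sumBelowRoot-1 : sumBelowRoot (λ _ → 1) ≡ m ∸ 1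
  sumBelowRoot-1 = trans (≡-sym (ℕ.m+n∸n≡m _ 1)) (cong (_∸ 1) (begin
    sumBelowRoot (λ _ → 1) + 1
      ≡⟨ cong (sumBelowRoot (λ _ → 1) +_) (∑-single ρ (λ _ → 1)) ⟨
    sumBelowRoot (λ _ → 1) + ∑ (λ i → if does (ρ Fin.≟ i) then 1 else 0)
      ≡⟨ ∑-distrib-+ {m} (λ i → if does (i Fin.≟ ρ) then 0 else 1) _ ⟨
    ∑ (λ i → (if does (i Fin.≟ ρ) then 0 else 1) + (if does (ρ Fin.≟ i) then 1 else 0))
      ≡⟨ ∑-cong one ⟩
    ∑ {m} (λ _ → 1)
      ≡⟨ ∑-1 m ⟩
    m ∎))
    where
    open ≡-Reasoning
    one : ∀ i → (if does (i Fin.≟ ρ) then 0 else 1) + (if does (ρ Fin.≟ i) then 1 else 0) ≡ 1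
    one i with i Fin.≟ ρ | ρ Fin.≟ i
    ... | yes _ | yes _ = refl
    ... | no _  | no _  = refl
    ... | yes e | no ne = contradiction (≡-sym e) ne
    ... | no ne | yes e = contradiction (≡-sym e) ne

  numEdges-treeOf : ∀ {p} → Rooted p → numEdges (treeOf p) ≡ m ∸ 1
  numEdges-treeOf rooted = trans (edgeSum-treeOf rooted (λ _ _ → 1) (λ _ _ → refl)) sumBelowRoot-1

  -- Every spanning tree comes from a parent function

  module _ (E : EdgeSet m) where

    -- Balls about `ρ` in the graph `E`, defined by recursion on the radius so that membership is
    -- decidable.
    Within : ℕ → Fin m → Set
    Within zero    i = i ≡ ρ
    Within (suc d) i = Within d i ⊎ ∃ λ j → T (E ⟨ i , j ⟩) × Within d j

    within? : ∀ d i → Dec (Within d i)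
    within? zero    i = i Fin.≟ ρ
    within? (suc d) i = within? d i ⊎-dec Fin.any? (λ j → T? (E ⟨ i , j ⟩) ×-dec within? d j)

    within-mono : ∀ {d e i} → d ≤ e → Within d i → Within e i
    within-mono {e = e} d≤e w = go (ℕ.≤⇒≤′ d≤e) w
      where
      go : ∀ {d e i} → d ≤′ e → Within d i → Within e i
      go ≤′-refl     w = w
      go (≤′-step h) w = inj₁ (go h w)

    walk⇒within : ∀ {i} → Walk (_⟨_,_⟩ E) ∅ i ρ → ∃ λ d → Within d i
    walk⇒within (here _)      = 0 , refl
    walk⇒within (there _ e w) = let d , wd = walk⇒within w in suc d , inj₂ (_ , e , wd)

    -- The next vertex on a shortest walk to ρ.
    Closer : Fin m → Set
    Closer i = ∃₂ λ d j → T (E ⟨ i , j ⟩) × Within d j × ¬ Within d i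

    closer : ∀ d {i} → i ≢ ρ → Within d i → Closer i
    closer zero        i≢ w = contradiction w i≢
    closer (suc d) {i} i≢ w with within? d i | w
    ... | yes w′ | _               = closer d i≢ w′
    ... | no ¬w  | inj₁ w′         = contradiction w′ ¬w
    ... | no ¬w  | inj₂ (j , e , v) = d , j , e , v , ¬w

    -- The breadth-first tree: each vertex is sent to a neighbour lying in a ball that does not
    -- contain the vertex itself. The distance to `ρ` drops at every step, so iteration reaches `ρ`.
    parentFunction : (∀ i → Walk (_⟨_,_⟩ E) ∅ i ρ) →
                     ∃ λ p → Rooted p × (∀ i → i ≢ ρ → T (E ⟨ i , p i ⟩))
    parentFunction conn =
      p , (λ i → let d , w = walk⇒within (conn i) in rooted d w) , λ i i≢ → proj₁ (p-closer i i≢)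
      where
      closerTo : ∀ i → i ≢ ρ → Closer i
      closerTo i i≢ = let d , w = walk⇒within (conn i) in closer d i≢ w
      p : Fin m → Fin m
      p i with i Fin.≟ ρ
      ... | yes _ = ρ
      ... | no i≢ = proj₁ (proj₂ (closerTo i i≢))
      p-closer : ∀ i → i ≢ ρ → T (E ⟨ i , p i ⟩) × ∃ λ d → Within d (p i) × ¬ Within d i
      p-closer i i≢ with i Fin.≟ ρ
      ... | yes i≡ = contradiction i≡ i≢
      ... | no i≢′ = let d , _ , e , w = closerTo i i≢′ in e , d , w
      rooted< : ∀ b d {i} → d < b → Within d i → Above p ρ i
      rooted< (suc b) d {i} (s≤s d≤b) w with i Fin.≟ ρ
      ... | yes refl = here
      ... | no i≢ with d′ , w′ , ¬w ← proj₂ (p-closer i i≢) with d ℕ.≤? d′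
      ...   | yes d≤d′ = contradiction (within-mono d≤d′ w) ¬w
      ...   | no d≰d′  = up i≢ (rooted< b d′ (ℕ.<-≤-trans (ℕ.≰⇒> d≰d′) d≤b) w′)
      rooted : ∀ d {i} → Within d i → Above p ρ i
      rooted d = rooted< (suc d) d ℕ.≤-refl

    -- The breadth-first tree is contained in `E` and has `m ∸ 1` edges, as many as `E`; so the two
    -- coincide.
    spanningTree-treeOf : (∀ i j → E ⟨ i , j ⟩ ≡ E ⟨ j , i ⟩) → (∀ i → E ⟨ i , i ⟩ ≡ false) →
                          (∀ i j → Walk (_⟨_,_⟩ E) ∅ i j) → numEdges E ≡ m ∸ 1 →
                          ∃ λ p → Rooted p × E ≡ treeOf p
    spanningTree-treeOf E-sym E-irrefl conn num
      with p , rooted , p∈E ← parentFunction (λ i → conn i ρ) =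
      p , rooted , EdgeSet-ext (λ i j → ≡-sym (same i j))
      where
      ind : EdgeSet m → Fin m → Fin m → ℕ
      ind F i j = if (toℕ i <ᵇ toℕ j) ∧ F ⟨ i , j ⟩ then 1 else 0
      tree⊆E : ∀ {i j} → T (treeOf p ⟨ i , j ⟩) → T (E ⟨ i , j ⟩)
      tree⊆E {i} {j} t with treeOf-edge⁻ p {i} {j} t
      ... | inj₁ (i≢ , refl) = p∈E i i≢
      ... | inj₂ (j≢ , refl) = subst T (E-sym j i) (p∈E j j≢)
      ind≤ : ∀ i j → ind (treeOf p) i j ≤ ind E i j
      ind≤ i j with toℕ i <ᵇ toℕ j | treeOf p ⟨ i , j ⟩ in e₁ | E ⟨ i , j ⟩ in e₂
      ... | false | _     | _     = z≤n
      ... | true  | false | _     = z≤n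
      ... | true  | true  | true  = ℕ.≤-refl
      ... | true  | true  | false = contradiction (tree⊆E (true⇒T e₁)) (subst (¬_ ∘ T) (≡-sym e₂) id)
      ind≡ : ∀ i j → ind (treeOf p) i j ≡ ind E i j
      -- Equality of the totals gives equality of the row sums, and this gives equality within each
      -- row.
      ind≡ i = ∑-tight (ind≤ i) (ℕ.≤-reflexive (≡-sym
        (∑-tight (λ i → ∑-mono-≤ (ind≤ i))
          (ℕ.≤-reflexive (trans num (≡-sym (numEdges-treeOf rooted)))) i)))
      same< : ∀ i j → (toℕ i <ᵇ toℕ j) ≡ true → treeOf p ⟨ i , j ⟩ ≡ E ⟨ i , j ⟩
      same< i j lt with ind≡ i j
      ... | eq rewrite lt with treeOf p ⟨ i , j ⟩ | E ⟨ i , j ⟩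
      ... | true  | true  = refl
      ... | false | false = refl
      same : ∀ i j → treeOf p ⟨ i , j ⟩ ≡ E ⟨ i , j ⟩
      same i j with i Fin.≟ j
      ... | yes refl = trans (treeOf-irrefl rooted i) (≡-sym (E-irrefl i))
      ... | no i≢j with toℕ i <ᵇ toℕ j in lt
      ...   | true  = same< i j lt
      ...   | false = trans (treeOf-sym p i j) (trans (same< j i gt) (E-sym j i))
        where
        gt : (toℕ j <ᵇ toℕ i) ≡ true
        gt = trans (<ᵇ-flip (toℕ j) (toℕ i) (i≢j ∘ ≡-sym ∘ Fin.toℕ-injective)) (cong not lt)

-- Cliques of k-trees

⊆∧∣≥∣⇒≡ : ∀ {n} {p q : Subset n} → p ⊆ₛ q → ∣ q ∣ ≤ ∣ p ∣ → p ≡ q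
⊆∧∣≥∣⇒≡ {p = p} {q} p⊆q ∣q∣≤∣p∣ = Subset.⊆-antisym p⊆q q⊆p
  where
  q⊆p : q ⊆ₛ p
  q⊆p {x} x∈q with x Subset.∈? p
  ... | yes x∈p = x∈p
  ... | no x∉p  = contradiction (Subset.p⊂q⇒∣p∣<∣q∣ (p⊆q , x , x∈q , x∉p)) (ℕ.≤⇒≯ ∣q∣≤∣p∣)

difference : ∀ {n} (C D : Subset n) → ∣ C ∣ ≡ ∣ D ∣ → C ≢ D → ∃ λ x → x ∈ₛ C × x ∉ₛ D
difference C D ∣C∣≡∣D∣ C≢D with Fin.any? (λ x → x Subset.∈? C ×-dec ¬? (x Subset.∈? D))
... | yes found = found
... | no none   = contradiction
  (⊆∧∣≥∣⇒≡ (λ {x} x∈C → decidable-stable (x Subset.∈? D) λ x∉D → none (x , x∈C , x∉D))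
    (ℕ.≤-reflexive (≡-sym ∣C∣≡∣D∣))) C≢D

∣insertAt-true∣ : ∀ {n} (C : Subset n) v → ∣ insertAt C v true ∣ ≡ suc ∣ C ∣
∣insertAt-true∣ C           zero    = refl
∣insertAt-true∣ (true  ∷ C) (suc v) = cong suc (∣insertAt-true∣ C v)
∣insertAt-true∣ (false ∷ C) (suc v) = ∣insertAt-true∣ C v

∣insertAt-false∣ : ∀ {n} (C : Subset n) v → ∣ insertAt C v false ∣ ≡ ∣ C ∣
∣insertAt-false∣ C           zero    = refl
∣insertAt-false∣ (true  ∷ C) (suc v) = cong suc (∣insertAt-false∣ C v)
∣insertAt-false∣ (false ∷ C) (suc v) = ∣insertAt-false∣ C v

-- Vertices and vertex sets when one vertex is inserted

module _ {n : ℕ} (v : Fin (suc n)) where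

  data PunchView : Fin (suc n) → Set where
    hole    : PunchView v
    punched : ∀ i → PunchView (punchIn v i)

  punchView : ∀ x → PunchView x
  punchView x with v Fin.≟ x
  ... | yes refl = hole
  ... | no v≢x   = subst PunchView (Fin.punchIn-punchOut v≢x) (punched _)

  data InsertView : Subset (suc n) → Set where
    ins : ∀ b C → InsertView (insertAt C v b)

  insertView : ∀ C → InsertView C
  insertView C = subst InsertView (Vec.insertAt-removeAt C v) (ins _ _)

  ∈-insert⁺ : ∀ {C b i} → i ∈ₛ C → punchIn v i ∈ₛ insertAt C v b
  ∈-insert⁺ {C} {b} {i} i∈C =
    Vec.lookup⇒[]= _ _ (trans (Vec.insertAt-punchIn C v b i) (Vec.[]=⇒lookup i∈C))

  ∈-insert⁻ : ∀ {C b i} → punchIn v i ∈ₛ insertAt C v b → i ∈ₛ C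
  ∈-insert⁻ {C} {b} {i} i∈C =
    Vec.lookup⇒[]= _ _ (trans (≡-sym (Vec.insertAt-punchIn C v b i)) (Vec.[]=⇒lookup i∈C))

  hole-∈⁺ : ∀ {C} → v ∈ₛ insertAt C v true
  hole-∈⁺ {C} = Vec.lookup⇒[]= _ _ (Vec.insertAt-lookup C v true)

  hole-∈⁻ : ∀ {C} {A : Set} → v ∈ₛ insertAt C v false → A
  hole-∈⁻ {C} v∈ with () ← trans (≡-sym (Vec.[]=⇒lookup v∈)) (Vec.insertAt-lookup C v false)

  insert-false-⊆⁺ : ∀ {C D b} → C ⊆ₛ D → insertAt C v false ⊆ₛ insertAt D v b
  insert-false-⊆⁺ C⊆D {x} x∈ with punchView x
  ... | hole      = hole-∈⁻ x∈
  ... | punched i = ∈-insert⁺ (C⊆D (∈-insert⁻ x∈))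

  insert-true-⊆⁺ : ∀ {C D b} → C ⊆ₛ D → insertAt C v b ⊆ₛ insertAt D v true
  insert-true-⊆⁺ C⊆D {x} x∈ with punchView x
  ... | hole      = hole-∈⁺
  ... | punched i = ∈-insert⁺ (C⊆D (∈-insert⁻ x∈))

  insert-⊆⁻ : ∀ {C D b b′} → insertAt C v b ⊆ₛ insertAt D v b′ → C ⊆ₛ D
  insert-⊆⁻ C⊆D i∈C = ∈-insert⁻ (C⊆D (∈-insert⁺ i∈C))

CliqueOfSize : ∀ {n} → Graph n → ℕ → Subset n → Set
CliqueOfSize G s C = IsClique G C × ∣ C ∣ ≡ s

module NewVertex {k n : ℕ} (G : Graph (suc n)) (v : Fin (suc n))
                 (N-clique : IsClique G (nbhd G v)) (∣N∣ : ∣ nbhd G v ∣ ≡ k) where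

  G′ : Graph n
  G′ = delete v G

  N′ : Subset n
  N′ = tabulate (λ i → adj G v (punchIn v i))

  ∈N′⁺ : ∀ {i} → Adj G v (punchIn v i) → i ∈ₛ N′
  ∈N′⁺ {i} a = Vec.lookup⇒[]= _ _ (trans (Vec.lookup∘tabulate _ i) (T⇒true a))

  ∈N′⁻ : ∀ {i} → i ∈ₛ N′ → Adj G v (punchIn v i)
  ∈N′⁻ {i} i∈ = true⇒T (trans (≡-sym (Vec.lookup∘tabulate _ i)) (Vec.[]=⇒lookup i∈))

  ∈N⁺ : ∀ {x} → Adj G v x → x ∈ₛ nbhd G v
  ∈N⁺ {x} a = Vec.lookup⇒[]= _ _ (trans (Vec.lookup∘tabulate (adj G v) x) (T⇒true a))

  ∈N⁻ : ∀ {x} → x ∈ₛ nbhd G v → Adj G v x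
  ∈N⁻ {x} x∈ = true⇒T (trans (≡-sym (Vec.lookup∘tabulate (adj G v) x)) (Vec.[]=⇒lookup x∈))

  adj-irrefl : ∀ {x} {A : Set} → Adj G x x → A
  adj-irrefl {x} a = ⊥-elim (subst T (irrefl G x) a)

  adj-sym : ∀ {x y} → Adj G x y → Adj G y x
  adj-sym {x} {y} = subst T (sym G x y)

  N≡ : nbhd G v ≡ insertAt N′ v false
  N≡ = Subset.⊆-antisym to from
    where
    to : nbhd G v ⊆ₛ insertAt N′ v false
    to {x} x∈ with punchView v x
    ... | hole      = adj-irrefl (∈N⁻ x∈)
    ... | punched i = ∈-insert⁺ v (∈N′⁺ (∈N⁻ x∈))
    from : insertAt N′ v false ⊆ₛ nbhd G v
    from {x} x∈ with punchView v x
    ... | hole      = hole-∈⁻ v x∈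
    ... | punched i = ∈N⁺ (∈N′⁻ (∈-insert⁻ v x∈))

  clique-drop : ∀ {C b} → IsClique G (insertAt C v b) → IsClique G′ C
  clique-drop cl i∈ j∈ i≢j =
    cl (∈-insert⁺ v i∈) (∈-insert⁺ v j∈) (i≢j ∘ Fin.punchIn-injective v _ _)

  clique-lift : ∀ {C} → IsClique G′ C → IsClique G (insertAt C v false)
  clique-lift cl {x} {y} x∈ y∈ x≢y with punchView v x | punchView v y
  ... | hole      | _         = hole-∈⁻ v x∈
  ... | punched _ | hole      = hole-∈⁻ v y∈
  ... | punched i | punched j = cl (∈-insert⁻ v x∈) (∈-insert⁻ v y∈) (x≢y ∘ cong (punchIn v))

  N′-clique : IsClique G′ N′
  N′-clique = clique-drop (subst (IsClique G) N≡ N-clique)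

  ∣N′∣ : ∣ N′ ∣ ≡ k
  ∣N′∣ = trans (≡-sym (∣insertAt-false∣ N′ v)) (trans (cong ∣_∣ (≡-sym N≡)) ∣N∣)

  newClique : Subset (suc n)
  newClique = insertAt N′ v true

  newClique-isClique : IsClique G newClique
  newClique-isClique {x} {y} x∈ y∈ x≢y with punchView v x | punchView v y
  ... | hole      | hole      = contradiction refl x≢y
  ... | hole      | punched j = ∈N′⁻ (∈-insert⁻ v y∈)
  ... | punched i | hole      = adj-sym (∈N′⁻ (∈-insert⁻ v x∈))
  ... | punched i | punched j =
    N′-clique (∈-insert⁻ v x∈) (∈-insert⁻ v y∈) (x≢y ∘ cong (punchIn v))

  ∣newClique∣ : ∣ newClique ∣ ≡ suc k
  ∣newClique∣ = trans (∣insertAt-true∣ N′ v) (cong suc ∣N′∣)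

  clique-hole : ∀ {C} → IsClique G (insertAt C v true) → C ⊆ₛ N′
  clique-hole cl i∈ = ∈N′⁺ (cl (hole-∈⁺ v) (∈-insert⁺ v i∈) (Fin.punchInᵢ≢i v _ ∘ ≡-sym))

  -- The other vertices of the clique are `k` neighbours of `v`, and `N′` has only `k` elements.
  -- Hence `newClique` is the only (k+1)-clique through `v`.
  hole-full : ∀ {C} → CliqueOfSize G (suc k) (insertAt C v true) → C ≡ N′
  hole-full {C} (cl , ∣C∣) = ⊆∧∣≥∣⇒≡ (clique-hole cl)
    (ℕ.≤-reflexive (trans ∣N′∣ (ℕ.suc-injective (trans (≡-sym ∣C∣) (∣insertAt-true∣ C v)))))

  size-drop : ∀ {C s} → CliqueOfSize G s (insertAt C v false) → CliqueOfSize G′ s C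
  size-drop {C} (cl , ∣C∣) = clique-drop cl , trans (≡-sym (∣insertAt-false∣ C v)) ∣C∣

  size-lift : ∀ {C s} → CliqueOfSize G′ s C → CliqueOfSize G s (insertAt C v false)
  size-lift {C} (cl , ∣C∣) = clique-lift cl , trans (∣insertAt-false∣ C v) ∣C∣

-- For a (k+1)-clique C other than `baseClique`, `sep C` is the k-clique by which C
-- was attached; `top S` is the first (k+1)-clique containing the k-clique S.
record Construction (k : ℕ) {n : ℕ} (G : Graph n) : Set where
  field
    baseClique : Subset n
    rank     : Subset n → ℕ
    sep top  : Subset n → Subset n
    base-ok  : CliqueOfSize G (suc k) baseClique
    rank≤    : ∀ {C} → CliqueOfSize G (suc k) C → rank C ≤ n
    top-ok   : ∀ {S} → CliqueOfSize G k S → CliqueOfSize G (suc k) (top S) × S ⊆ₛ top S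
    sep-ok   : ∀ {C} → CliqueOfSize G (suc k) C → C ≢ baseClique →
               CliqueOfSize G k (sep C) × sep C ⊆ₛ C × rank (top (sep C)) < rank C
    facet    : ∀ {C S} → CliqueOfSize G (suc k) C → CliqueOfSize G k S → S ⊆ₛ C →
               C ≡ top S ⊎ (C ≢ baseClique × S ≡ sep C)
    extend-clique : ∀ {C} → IsClique G C → ∃ λ D → CliqueOfSize G (suc k) D × C ⊆ₛ D
    ∣clique∣≤ : ∀ {C} → IsClique G C → ∣ C ∣ ≤ suc k

complete-construction : ∀ {k} (G : Graph (suc k)) → (∀ u v → u ≢ v → Adj G u v) → Construction k G
complete-construction {k} G complete = record
  -- The whole vertex set is the only (k+1)-clique. `sep = id` is a filler, as there is no clique
  -- other than `baseClique`.
  { baseClique = ⊤ ; rank = λ _ → 0 ; sep = id ; top = λ _ → ⊤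
  ; base-ok = ⊤-ok
  ; rank≤ = λ _ → z≤n
  ; top-ok = λ _ → ⊤-ok , Subset.⊆⊤
  ; sep-ok = λ (_ , ∣C∣) C≢⊤ → contradiction (Subset.∣p∣≡n⇒p≡⊤ ∣C∣) C≢⊤
  ; facet = λ (_ , ∣C∣) _ _ → inj₁ (Subset.∣p∣≡n⇒p≡⊤ ∣C∣)
  ; extend-clique = λ _ → ⊤ , ⊤-ok , Subset.⊆⊤
  ; ∣clique∣≤ = λ {C} _ → Subset.∣p∣≤n C
  }
  where
  ⊤-ok : CliqueOfSize G (suc k) ⊤
  ⊤-ok = (λ _ _ → complete _ _) , Subset.∣⊤∣≡n (suc k)

-- Sets avoiding `v` keep their data. A k-clique through `v` lies in no (k+1)-clique but
-- `newClique`, which is therefore its `top`; `newClique` itself is attached along `N′`, whose `top`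
-- is an old clique.
attach-construction : ∀ {k n} (G : Graph (suc n)) (v : Fin (suc n)) → Construction k (delete v G) →
                      IsClique G (nbhd G v) → ∣ nbhd G v ∣ ≡ k → Construction k G
attach-construction {k} {n} G v K′ N-clique ∣N∣ = record
  { baseClique = insertAt K.baseClique v false
  ; rank = rank ; sep = sep ; top = top
  ; base-ok = size-lift K.base-ok
  ; rank≤ = rank≤ ; top-ok = top-ok ; sep-ok = sep-ok ; facet = facet
  ; extend-clique = extend-clique ; ∣clique∣≤ = ∣clique∣≤
  }
  where
  module K = Construction K′
  open NewVertex G v N-clique ∣N∣

  split : {A : Set} → (Subset n → A) → A → Subset (suc n) → A
  split old new C = if lookup C v then new else old (removeAt C v)

  split-true : ∀ {A : Set} (old : Subset n → A) new C → split old new (insertAt C v true) ≡ new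
  split-true old new C rewrite Vec.insertAt-lookup C v true = refl

  split-false : ∀ {A : Set} (old : Subset n → A) new C → split old new (insertAt C v false) ≡ old C
  split-false old new C rewrite Vec.insertAt-lookup C v false | Vec.removeAt-insertAt C v false = refl

  -- The rank is a time of attachment: old cliques have rank at most `n`, so `suc n` exceeds them
  -- all.
  rank : Subset (suc n) → ℕ
  rank = split K.rank (suc n)
  sep top : Subset (suc n) → Subset (suc n)
  sep = split (λ C → insertAt (K.sep C) v false) (insertAt N′ v false)
  top = split (λ S → insertAt (K.top S) v false) newClique

  new-ok : CliqueOfSize G (suc k) newClique
  new-ok = newClique-isClique , ∣newClique∣

  rank≤ : ∀ {C} → CliqueOfSize G (suc k) C → rank C ≤ suc n
  rank≤ {C} ok with insertView v C
  ... | ins true  D rewrite split-true K.rank (suc n) D  = ℕ.≤-refl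
  ... | ins false D rewrite split-false K.rank (suc n) D = ℕ.m≤n⇒m≤1+n (K.rank≤ (size-drop ok))

  top-ok : ∀ {S} → CliqueOfSize G k S → CliqueOfSize G (suc k) (top S) × S ⊆ₛ top S
  top-ok {S} ok with insertView v S
  ... | ins true D rewrite split-true (λ S → insertAt (K.top S) v false) newClique D =
    new-ok , insert-true-⊆⁺ v (clique-hole (proj₁ ok))
  ... | ins false D rewrite split-false (λ S → insertAt (K.top S) v false) newClique D =
    let ok′ , D⊆ = K.top-ok (size-drop ok) in size-lift ok′ , insert-false-⊆⁺ v D⊆

  top-false : ∀ S → top (insertAt S v false) ≡ insertAt (K.top S) v false
  top-false = split-false (λ S → insertAt (K.top S) v false) newClique

  sep-ok : ∀ {C} → CliqueOfSize G (suc k) C → C ≢ insertAt K.baseClique v false →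
           CliqueOfSize G k (sep C) × sep C ⊆ₛ C × rank (top (sep C)) < rank C
  sep-ok {C} ok C≢ with insertView v C
  ... | ins true D
    rewrite split-true (λ C → insertAt (K.sep C) v false) (insertAt N′ v false) D
          | split-true K.rank (suc n) D
          | top-false N′
          | split-false K.rank (suc n) (K.top N′) =
    size-lift N′-ok
    , insert-false-⊆⁺ v (subst (N′ ⊆ₛ_) (≡-sym (hole-full ok)) Subset.⊆-refl)
    , s≤s (K.rank≤ (proj₁ (K.top-ok N′-ok)))
    where
    N′-ok : CliqueOfSize G′ k N′
    N′-ok = N′-clique , ∣N′∣
  ... | ins false D
    rewrite split-false (λ C → insertAt (K.sep C) v false) (insertAt N′ v false) D
          | split-false K.rank (suc n) D
          | top-false (K.sep D)
          | split-false K.rank (suc n) (K.top (K.sep D)) =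
    let ok′ , ⊆D , rk = K.sep-ok (size-drop ok) (λ { refl → C≢ refl })
    in size-lift ok′ , insert-false-⊆⁺ v ⊆D , rk

  facet : ∀ {C S} → CliqueOfSize G (suc k) C → CliqueOfSize G k S → S ⊆ₛ C →
          C ≡ top S ⊎ (C ≢ insertAt K.baseClique v false × S ≡ sep C)
  facet {C} {S} okC okS S⊆C with insertView v C | insertView v S
  ... | ins true D | ins true T
    rewrite split-true (λ S → insertAt (K.top S) v false) newClique T =
    inj₁ (cong (λ X → insertAt X v true) (hole-full okC))
  ... | ins true D | ins false T
    rewrite split-true (λ C → insertAt (K.sep C) v false) (insertAt N′ v false) D =
    inj₂ ( (λ e → hole-∈⁻ v (subst (v ∈ₛ_) e (hole-∈⁺ v)))
         , cong (λ X → insertAt X v false)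
             (⊆∧∣≥∣⇒≡ (subst (T ⊆ₛ_) (hole-full okC) (insert-⊆⁻ v S⊆C))
               (ℕ.≤-reflexive (trans ∣N′∣ (≡-sym (proj₂ (size-drop okS)))))))
  ... | ins false D | ins true T = hole-∈⁻ v (S⊆C (hole-∈⁺ v))
  ... | ins false D | ins false T
    rewrite split-false (λ C → insertAt (K.sep C) v false) (insertAt N′ v false) D
          | top-false T
    with K.facet (size-drop okC) (size-drop okS) (insert-⊆⁻ v S⊆C)
  ...   | inj₁ refl        = inj₁ refl
  ...   | inj₂ (D≢ , refl) = inj₂ (D≢ ∘ insert-injective , refl)
    where
    insert-injective : ∀ {X Y} → insertAt X v false ≡ insertAt Y v false → X ≡ Y
    insert-injective {X} {Y} e = trans (≡-sym (Vec.removeAt-insertAt X v false))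
      (trans (cong (λ Z → removeAt Z v) e) (Vec.removeAt-insertAt Y v false))

  extend-clique : ∀ {C} → IsClique G C → ∃ λ D → CliqueOfSize G (suc k) D × C ⊆ₛ D
  extend-clique {C} cl with insertView v C
  ... | ins true D  = newClique , new-ok , insert-true-⊆⁺ v (clique-hole cl)
  ... | ins false D =
    let X , ok , D⊆X = K.extend-clique (clique-drop cl)
    in insertAt X v false , size-lift ok , insert-false-⊆⁺ v D⊆X

  ∣clique∣≤ : ∀ {C} → IsClique G C → ∣ C ∣ ≤ suc k
  ∣clique∣≤ {C} cl with insertView v C
  ... | ins true D rewrite ∣insertAt-true∣ D v =
    s≤s (ℕ.≤-trans (Subset.p⊆q⇒∣p∣≤∣q∣ (clique-hole cl)) (ℕ.≤-reflexive ∣N′∣))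
  ... | ins false D rewrite ∣insertAt-false∣ D v = K.∣clique∣≤ (clique-drop cl)

construction : ∀ {k n} {G : Graph n} → KTree k G → Construction k G
construction (base G complete)      = complete-construction G complete
construction (step G v t N-clique ∣N∣) = attach-construction G v (construction t) N-clique ∣N∣

-- Induction on the last vertex `v`. If `v` lies in one of the two cliques, then `S` is the whole
-- neighbourhood of `v`, which is isolated once `S` is removed. If `v` lies in neither, a walk can
-- skip `v`: the vertices before and after it lie in the clique `N′`, hence are equal or adjacent.
separation : ∀ {k n} {G : Graph n} → KTree k G → ∀ {C D S a b} →
             CliqueOfSize G (suc k) C → CliqueOfSize G (suc k) D → ∣ S ∣ ≡ k → C ≢ D →
             S ⊆ₛ C → S ⊆ₛ D → a ∈ₛ C → a ∉ₛ S → b ∈ₛ D → b ∉ₛ S → ¬ Walk (adj G) S a b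
separation (base G _) (_ , ∣C∣) (_ , ∣D∣) _ C≢D =
  contradiction (trans (Subset.∣p∣≡n⇒p≡⊤ ∣C∣) (≡-sym (Subset.∣p∣≡n⇒p≡⊤ ∣D∣))) C≢D
separation {k} (step {n} G v t N-clique ∣N∣) {C} {D} {S} {a} {b} okC okD ∣S∣ C≢D S⊆C S⊆D a∈C a∉S b∈D b∉S
  = go (insertView v C) (insertView v D) (insertView v S) okC okD ∣S∣ C≢D S⊆C S⊆D a∈C a∉S b∈D b∉S
  where
  open NewVertex G v N-clique ∣N∣

  module _ {S : Subset n} where

    S⁺ = insertAt S v false

    mutual
      -- The ends are tied to `i` and `j` by equations, because an index of the form `punchIn v i`
      -- cannot be matched on.
      project : ∀ {x y i j} → x ≡ punchIn v i → y ≡ punchIn v j →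
                 Walk (adj G) S⁺ x y → Walk (adj G′) S i j
      project {i = i} e₁ e₂ (here x∉) with refl ← Fin.punchIn-injective v _ _ (trans (≡-sym e₁) e₂) =
        here (λ i∈ → x∉ (subst (_∈ₛ S⁺) (≡-sym e₁) (∈-insert⁺ v i∈)))
      project refl e₂ (there {w = y} x∉ a w) with punchView v y
      ... | hole      = bypass (λ i∈ → x∉ (∈-insert⁺ v i∈)) (∈N′⁺ (adj-sym a)) refl e₂ w
      ... | punched _ = there (λ i∈ → x∉ (∈-insert⁺ v i∈)) a (project refl e₂ w)

      bypass : ∀ {i x y j} → i ∉ₛ S → i ∈ₛ N′ → x ≡ v → y ≡ punchIn v j →
               Walk (adj G) S⁺ x y → Walk (adj G′) S i j
      bypass i∉ i∈N e₁ e₂ (here _) = contradiction (trans (≡-sym e₂) e₁) (Fin.punchInᵢ≢i v _)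
      bypass {i} i∉ i∈N refl e₂ (there {w = y} _ a w) with punchView v y
      ... | hole = adj-irrefl a
      ... | punched l with i Fin.≟ l
      ...   | yes refl = project refl e₂ w
      ...   | no i≢l   = there i∉ (N′-clique i∈N (∈N′⁺ a) i≢l) (project refl e₂ w)

  walk-start : ∀ {S x y} → Walk (adj G) S x y → x ∉ₛ S
  walk-start (here x∉)      = x∉
  walk-start (there x∉ _ _) = x∉

  isolated-start : ∀ {x y} → x ≡ v → y ≢ v → ¬ Walk (adj G) (insertAt N′ v false) x y
  isolated-start e    y≢ (here _)      = y≢ e
  isolated-start refl y≢ (there _ a w) = walk-start w (subst (_ ∈ₛ_) N≡ (∈N⁺ a))

  isolated-end : ∀ {x y} → y ≡ v → x ≢ v → ¬ Walk (adj G) (insertAt N′ v false) x y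
  isolated-end e x≢ (here _) = x≢ e
  isolated-end e x≢ (there {w = z} x∉ a w) with z Fin.≟ v
  ... | yes refl = x∉ (subst (_ ∈ₛ_) N≡ (∈N⁺ (adj-sym a)))
  ... | no z≢    = isolated-end e z≢ w

  facet-is-N′ : ∀ {C S} → CliqueOfSize G (suc k) (insertAt C v true) → ∣ insertAt S v false ∣ ≡ k →
                insertAt S v false ⊆ₛ insertAt C v true → S ≡ N′
  facet-is-N′ {C} {S} okC ∣S∣ S⊆C = ⊆∧∣≥∣⇒≡ (subst (S ⊆ₛ_) (hole-full okC) (insert-⊆⁻ v S⊆C))
    (ℕ.≤-reflexive (trans ∣N′∣ (≡-sym (trans (≡-sym (∣insertAt-false∣ S v)) ∣S∣))))

  only-hole : ∀ {x} → x ∈ₛ newClique → x ∉ₛ insertAt N′ v false → x ≡ v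
  only-hole {x} x∈ x∉ with punchView v x
  ... | hole      = refl
  ... | punched i = contradiction (∈-insert⁺ v (∈-insert⁻ v x∈)) x∉

  go : ∀ {C D S a b} → InsertView v C → InsertView v D → InsertView v S →
       CliqueOfSize G (suc k) C → CliqueOfSize G (suc k) D → ∣ S ∣ ≡ k → C ≢ D →
       S ⊆ₛ C → S ⊆ₛ D → a ∈ₛ C → a ∉ₛ S → b ∈ₛ D → b ∉ₛ S → ¬ Walk (adj G) S a b
  go (ins true C) (ins true D) _ okC okD _ C≢D =
    contradiction (cong (λ X → insertAt X v true) (trans (hole-full okC) (≡-sym (hole-full okD)))) C≢D
  go (ins true C) (ins false D) (ins true S) _ _ _ _ _ S⊆D = hole-∈⁻ v (S⊆D (hole-∈⁺ v))
  go (ins false C) _ (ins true S) _ _ _ _ S⊆C = hole-∈⁻ v (S⊆C (hole-∈⁺ v))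
  go (ins true C) (ins false D) (ins false S) okC okD ∣S∣ _ S⊆C S⊆D a∈C a∉S b∈D b∉S
    with refl ← hole-full okC | refl ← facet-is-N′ okC ∣S∣ S⊆C =
    isolated-start (only-hole a∈C a∉S) λ { refl → hole-∈⁻ v b∈D }
  go (ins false C) (ins true D) (ins false S) okC okD ∣S∣ _ S⊆C S⊆D a∈C a∉S b∈D b∉S
    with refl ← hole-full okD | refl ← facet-is-N′ okD ∣S∣ S⊆D =
    isolated-end (only-hole b∈D b∉S) λ { refl → hole-∈⁻ v a∈C }
  go {a = a} {b} (ins false C) (ins false D) (ins false S) okC okD ∣S∣ C≢D S⊆C S⊆D a∈C a∉S b∈D b∉S w
    with punchView v a | punchView v b
  ... | hole      | _         = hole-∈⁻ v a∈C
  ... | punched _ | hole      = hole-∈⁻ v b∈D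
  ... | punched i | punched j =
    separation t (size-drop okC) (size-drop okD) (trans (≡-sym (∣insertAt-false∣ S v)) ∣S∣)
      (C≢D ∘ cong (λ X → insertAt X v false)) (insert-⊆⁻ v S⊆C) (insert-⊆⁻ v S⊆D)
      (∈-insert⁻ v a∈C) (a∉S ∘ ∈-insert⁺ v) (∈-insert⁻ v b∈D) (b∉S ∘ ∈-insert⁺ v)
      (project refl refl w)

-- The pair separated consists of a vertex `a` of `C` outside `D` and a vertex `b` of `D` outside
-- `C`. Each vertex of `S` is adjacent to both, so leaving one out of the separator opens a path of
-- length two.
separator-isMVS : ∀ {k n} {G : Graph n} → KTree k G → ∀ {C D S} →
                  CliqueOfSize G (suc k) C → CliqueOfSize G (suc k) D → ∣ S ∣ ≡ k → C ≢ D →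
                  S ⊆ₛ C → S ⊆ₛ D → IsMVS G S
separator-isMVS {k} {G = G} t {C} {D} {S} okC okD ∣S∣ C≢D S⊆C S⊆D
  with a , a∈C , a∉D ← difference C D (trans (proj₂ okC) (≡-sym (proj₂ okD))) C≢D
  with b , b∈D , b∉C ← difference D C (trans (proj₂ okD) (≡-sym (proj₂ okC))) (C≢D ∘ ≡-sym) =
  a , b
  , (λ ab → separated (there a∉S ab (here b∉S)))
  , (a∉S , b∉S , separated)
  , minimal
  where
  a∉S : a ∉ₛ S
  a∉S = a∉D ∘ S⊆D
  b∉S : b ∉ₛ S
  b∉S = b∉C ∘ S⊆C
  separated : ¬ Walk (adj G) S a b
  separated = separation t okC okD ∣S∣ C≢D S⊆C S⊆D a∈C a∉S b∈D b∉S
  minimal : ∀ S′ → S′ ⊂ S → ¬ Separates G S′ a b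
  minimal S′ (_ , s , s∈S , s∉S′) (a∉S′ , b∉S′ , ¬walk) = ¬walk
    (there a∉S′ (proj₁ okC a∈C (S⊆C s∈S) λ { refl → a∉S s∈S })
      (there s∉S′ (proj₁ okD (S⊆D s∈S) b∈D λ { refl → b∉S s∈S }) (here b∉S′)))

-- Clique trees as labelled forests

∣∩∣≤ : ∀ {n k} {C D : Subset n} → ∣ C ∣ ≡ suc k → ∣ D ∣ ≡ suc k → C ≢ D → ∣ C ∩ D ∣ ≤ k
∣∩∣≤ {C = C} {D} ∣C∣ ∣D∣ C≢D
  with x , x∈C , x∉D ← difference C D (trans ∣C∣ (≡-sym ∣D∣)) C≢D =
  ℕ.≤-pred (ℕ.≤-trans
    (Subset.p⊂q⇒∣p∣<∣q∣ (Subset.p∩q⊆p C D , x , x∈C , x∉D ∘ proj₂ ∘ Subset.x∈p∩q⁻ C D))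
    (ℕ.≤-reflexive ∣C∣))

∩≡facet : ∀ {n k} {C D S : Subset n} → ∣ C ∣ ≡ suc k → ∣ D ∣ ≡ suc k → C ≢ D →
          ∣ S ∣ ≡ k → S ⊆ₛ C → S ⊆ₛ D → C ∩ D ≡ S
∩≡facet ∣C∣ ∣D∣ C≢D ∣S∣ S⊆C S⊆D = ≡-sym (⊆∧∣≥∣⇒≡
  (λ x∈S → Subset.x∈p∩q⁺ (S⊆C x∈S , S⊆D x∈S))
  (ℕ.≤-trans (∣∩∣≤ ∣C∣ ∣D∣ C≢D) (ℕ.≤-reflexive (≡-sym ∣S∣))))

∣p∣>0⇒Nonempty : ∀ {n} (p : Subset n) → 1 ≤ ∣ p ∣ → Nonempty p
∣p∣>0⇒Nonempty {n} p 1≤∣p∣ with Subset.nonempty? p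
... | yes ne = ne
... | no ¬ne with () ← subst (1 ≤_) (trans (cong ∣_∣ (Subset.Empty-unique ¬ne)) (Subset.∣⊥∣≡0 n)) 1≤∣p∣

module CliqueTrees {k n : ℕ} (1≤k : 1 ≤ k) {G : Graph n} (kTree : KTree k G)
                   {m : ℕ} (Q : Fin m → Subset n) (Q-enum : EnumMaxCliques G Q) where

  open Construction (construction kTree)

  Q-injective : ∀ {i j} → Q i ≡ Q j → i ≡ j
  Q-injective = proj₁ Q-enum _ _

  Q-ok : ∀ i → CliqueOfSize G (suc k) (Q i)
  Q-ok i with cl , maximal ← proj₁ (proj₂ Q-enum) i
         with D , (clD , ∣D∣) , Q⊆D ← extend-clique cl =
    cl , trans (cong ∣_∣ (≡-sym (maximal D clD Q⊆D))) ∣D∣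

  index : ∀ {C} → CliqueOfSize G (suc k) C → ∃ λ i → Q i ≡ C
  index {C} (cl , ∣C∣) = proj₂ (proj₂ Q-enum) C
    (cl , λ D clD C⊆D → ≡-sym (⊆∧∣≥∣⇒≡ C⊆D (ℕ.≤-trans (∣clique∣≤ clD) (ℕ.≤-reflexive (≡-sym ∣C∣)))))

  ρ : Fin m
  ρ = proj₁ (index base-ok)

  open RootedTree ρ

  Q≢base : ∀ {i} → i ≢ ρ → Q i ≢ baseClique
  Q≢base i≢ e = i≢ (Q-injective (trans e (≡-sym (proj₂ (index base-ok)))))

  κ : Fin m → Subset n
  κ i = sep (Q i)

  κ-ok : ∀ {i} → i ≢ ρ → CliqueOfSize G k (κ i)
  κ-ok i≢ = proj₁ (sep-ok (Q-ok _) (Q≢base i≢))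

  κ⊆Q : ∀ {i} → i ≢ ρ → κ i ⊆ₛ Q i
  κ⊆Q i≢ = proj₁ (proj₂ (sep-ok (Q-ok _) (Q≢base i≢)))

  -- The parent function of a reference clique tree, which shows that weight `k` on all edges is
  -- attainable. The value at `ρ` is a default.
  τ : Fin m → Fin m
  τ i with i Fin.≟ ρ
  ... | yes _ = ρ
  ... | no i≢ = proj₁ (index (proj₁ (top-ok (κ-ok i≢))))

  Qτ : ∀ {i} → i ≢ ρ → Q (τ i) ≡ top (κ i)
  Qτ {i} i≢ with i Fin.≟ ρ
  ... | yes i≡ = contradiction i≡ i≢
  ... | no i≢′ = proj₂ (index (proj₁ (top-ok (κ-ok i≢′))))

  rank-τ : ∀ {i} → i ≢ ρ → rank (Q (τ i)) < rank (Q i)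
  rank-τ {i} i≢ = subst (λ C → rank C < rank (Q i)) (≡-sym (Qτ i≢))
    (proj₂ (proj₂ (sep-ok (Q-ok i) (Q≢base i≢))))

  κ≡⇒τ≡ : ∀ {i j} → i ≢ ρ → j ≢ ρ → κ i ≡ κ j → τ i ≡ τ j
  κ≡⇒τ≡ i≢ j≢ e = Q-injective (trans (Qτ i≢) (trans (cong top e) (≡-sym (Qτ j≢))))

  κ⊆Qτ : ∀ {i} → i ≢ ρ → κ i ⊆ₛ Q (τ i)
  κ⊆Qτ {i} i≢ = subst (κ i ⊆ₛ_) (≡-sym (Qτ i≢)) (proj₂ (top-ok (κ-ok i≢)))

  τ≢ : ∀ {i} → i ≢ ρ → τ i ≢ i
  τ≢ i≢ e = ℕ.<-irrefl (cong (rank ∘ Q) e) (rank-τ i≢)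

  Q∩Q≡κ : ∀ {i j} → i ≢ ρ → j ≢ i → κ i ⊆ₛ Q j → Q i ∩ Q j ≡ κ i
  Q∩Q≡κ {i} {j} i≢ j≢i κ⊆Qj = ∩≡facet (proj₂ (Q-ok i)) (proj₂ (Q-ok j))
    (λ e → j≢i (≡-sym (Q-injective e))) (proj₂ (κ-ok i≢)) (κ⊆Q i≢) κ⊆Qj

  Q∩Qτ≡κ : ∀ {i} → i ≢ ρ → Q i ∩ Q (τ i) ≡ κ i
  Q∩Qτ≡κ i≢ = Q∩Q≡κ i≢ (τ≢ i≢) (κ⊆Qτ i≢)

  Q∩Qsibling≡κ : ∀ {i j} → i ≢ ρ → j ≢ ρ → j ≢ i → κ j ≡ κ i → Q i ∩ Q j ≡ κ i
  Q∩Qsibling≡κ {j = j} i≢ j≢ j≢i e = Q∩Q≡κ i≢ j≢i (subst (_⊆ₛ Q j) e (κ⊆Q j≢))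

  -- Edges of weight k

  Related : Fin m → Fin m → Set
  Related i j = (i ≢ ρ × j ≢ ρ × κ j ≡ κ i) ⊎ (i ≢ ρ × j ≡ τ i) ⊎ (j ≢ ρ × i ≡ τ j)

  -- The intersection `S` is a k-clique, so by `facet` each of the two cliques is `top S` or was
  -- attached along `S`; being distinct, they are not both `top S`.
  related : ∀ {i j} → i ≢ j → ∣ Q i ∩ Q j ∣ ≡ k → Related i j
  related {i} {j} i≢j ∣S∣ =
    go (facet (Q-ok i) S-ok (Subset.p∩q⊆p (Q i) (Q j))) (facet (Q-ok j) S-ok (Subset.p∩q⊆q (Q i) (Q j)))
    where
    S = Q i ∩ Q j
    S-ok : CliqueOfSize G k S
    S-ok = (λ u∈ v∈ → proj₁ (Q-ok i) (Subset.p∩q⊆p (Q i) (Q j) u∈) (Subset.p∩q⊆p (Q i) (Q j) v∈)) , ∣S∣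
    ≢ρ : ∀ {i} → Q i ≢ baseClique → i ≢ ρ
    ≢ρ Qi≢ refl = Qi≢ (proj₂ (index base-ok))
    is-τ : ∀ {i j} → Q i ≢ baseClique → S ≡ κ i → Q j ≡ top S → j ≡ τ i
    is-τ Qi≢ S≡ Qj≡ = Q-injective (trans Qj≡ (trans (cong top S≡) (≡-sym (Qτ (≢ρ Qi≢)))))
    go : Q i ≡ top S ⊎ (Q i ≢ baseClique × S ≡ κ i) → Q j ≡ top S ⊎ (Q j ≢ baseClique × S ≡ κ j) →
         Related i j
    go (inj₁ e)         (inj₁ e′)          = contradiction (Q-injective (trans e (≡-sym e′))) i≢j
    go (inj₁ e)         (inj₂ (Qj≢ , e′))  = inj₂ (inj₂ (≢ρ Qj≢ , is-τ Qj≢ e′ e))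
    go (inj₂ (Qi≢ , e)) (inj₁ e′)          = inj₂ (inj₁ (≢ρ Qi≢ , is-τ Qi≢ e e′))
    go (inj₂ (Qi≢ , e)) (inj₂ (Qj≢ , e′))  = inj₁ (≢ρ Qi≢ , ≢ρ Qj≢ , trans (≡-sym e′) e)

  Tight : (Fin m → Fin m) → Set
  Tight p = ∀ i → i ≢ ρ → ∣ Q i ∩ Q (p i) ∣ ≡ k

  weight-treeOf : ∀ {p} → Rooted p → weight Q (treeOf p) ≡ sumBelowRoot (λ i → ∣ Q i ∩ Q (p i) ∣)
  weight-treeOf rooted = edgeSum-treeOf rooted _ (λ i j → cong ∣_∣ (Subset.∩-comm (Q i) (Q j)))

  edge-weight≤ : ∀ {p} → Rooted p → ∀ i → i ≢ ρ → ∣ Q i ∩ Q (p i) ∣ ≤ k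
  edge-weight≤ rooted i i≢ = ∣∩∣≤ (proj₂ (Q-ok i)) (proj₂ (Q-ok _))
    (λ e → parent≢ rooted i≢ (≡-sym (Q-injective e)))

  spanningTree⇒parents : ∀ {E} → IsSpanningTreeCI Q E → ∃ λ p → Rooted p × E ≡ treeOf p
  spanningTree⇒parents {E} (E-sym , E-irrefl , _ , conn , num) =
    spanningTree-treeOf E E-sym E-irrefl conn num

  tight⇒spanningTree : ∀ {p} → Rooted p → Tight p → IsSpanningTreeCI Q (treeOf p)
  tight⇒spanningTree {p} rooted tight =
    treeOf-sym p , treeOf-irrefl rooted , meets , treeOf-connected rooted , numEdges-treeOf rooted
    where
    tight-nonempty : ∀ {i} → i ≢ ρ → Nonempty (Q i ∩ Q (p i))
    -- Here `1 ≤ k` guarantees that an edge of weight `k` belongs to the clique-intersection graph.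
    tight-nonempty i≢ = ∣p∣>0⇒Nonempty _ (subst (1 ≤_) (≡-sym (tight _ i≢)) 1≤k)
    meets : ∀ i j → T (treeOf p ⟨ i , j ⟩) → Nonempty (Q i ∩ Q j)
    meets i j t with treeOf-edge⁻ p {i} {j} t
    ... | inj₁ (i≢ , refl) = tight-nonempty i≢
    ... | inj₂ (j≢ , refl) = subst Nonempty (Subset.∩-comm (Q j) (Q i)) (tight-nonempty j≢)

  weight-tight : ∀ {p} → Rooted p → Tight p → weight Q (treeOf p) ≡ sumBelowRoot (λ _ → k)
  weight-tight rooted tight = trans (weight-treeOf rooted) (sumBelowRoot-cong tight)

  tight⇒cliqueTree : ∀ {p} → Rooted p → Tight p → IsCliqueTree Q (treeOf p)
  tight⇒cliqueTree {p} rooted tight = tight⇒spanningTree rooted tight , heaviest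
    where
    heaviest : ∀ E → IsSpanningTreeCI Q E → weight Q E ≤ weight Q (treeOf p)
    heaviest E st with q , rooted′ , refl ← spanningTree⇒parents {E} st = begin
      weight Q (treeOf q)                       ≡⟨ weight-treeOf rooted′ ⟩
      sumBelowRoot (λ i → ∣ Q i ∩ Q (q i) ∣)    ≤⟨ sumBelowRoot-mono-≤ (edge-weight≤ rooted′) ⟩
      sumBelowRoot (λ _ → k)                    ≡⟨ weight-tight rooted tight ⟨
      weight Q (treeOf p)                       ∎
      where open ℕ.≤-Reasoning

  τ-rooted : Rooted τ
  τ-rooted i = go (suc (rank (Q i))) i ℕ.≤-refl
    where
    go : ∀ b i → rank (Q i) < b → Above τ ρ i
    go (suc b) i (s≤s le) with i Fin.≟ ρ
    ... | yes refl = here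
    ... | no i≢    = up i≢ (go b (τ i) (ℕ.<-≤-trans (rank-τ i≢) le))

  τ-tight : Tight τ
  τ-tight i i≢ = trans (cong ∣_∣ (Q∩Qτ≡κ i≢)) (proj₂ (κ-ok i≢))

  -- A heaviest tree weighs at least as much as the tree of `τ`, whose edges all attain the bound
  -- `k`; so its own edges attain it too.
  cliqueTree⇒tight : ∀ {E} → IsCliqueTree Q E → ∃ λ p → Rooted p × Tight p × E ≡ treeOf p
  cliqueTree⇒tight {E} (st , heaviest) with p , rooted , refl ← spanningTree⇒parents {E} st =
    p , rooted , sumBelowRoot-tight (edge-weight≤ rooted) (begin
      sumBelowRoot (λ _ → k)                    ≡⟨ weight-tight τ-rooted τ-tight ⟨
      weight Q (treeOf τ)                       ≤⟨ heaviest (treeOf τ) (tight⇒spanningTree τ-rooted τ-tight) ⟩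
      weight Q (treeOf p)                       ≡⟨ weight-treeOf rooted ⟩
      sumBelowRoot (λ i → ∣ Q i ∩ Q (p i) ∣)    ∎) , refl
    where open ℕ.≤-Reasoning

  -- The τ-descendants of i can only be left through i, so the path of p from a
  -- τ-descendant of i to ρ runs through i.
  leave-descendants : ∀ {p} → Rooted p → Tight p → ∀ {i} → i ≢ ρ → ∀ {x} → Above p ρ x →
                      Above τ i x → Above p i x
  leave-descendants rooted tight i≢ here here      = here
  leave-descendants rooted tight i≢ here (up ρ≢ _) = contradiction refl ρ≢
  leave-descendants rooted tight i≢ (up _ _) here  = here
  leave-descendants rooted tight i≢ {x} (up x≢ h) a@(up _ a′)
    with related (parent≢ rooted x≢ ∘ ≡-sym) (tight x x≢)
  ... | inj₁ (_ , y≢ , κ≡)       =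
    up x≢ (leave-descendants rooted tight i≢ h
      (up y≢ (subst (Above τ _) (≡-sym (κ≡⇒τ≡ y≢ x≢ κ≡)) a′)))
  ... | inj₂ (inj₁ (_ , y≡τx))   =
    up x≢ (leave-descendants rooted tight i≢ h (subst (Above τ _) (≡-sym y≡τx) a′))
  ... | inj₂ (inj₂ (y≢ , x≡τy))  =
    up x≢ (leave-descendants rooted tight i≢ h (up y≢ (subst (Above τ _) x≡τy a)))

  -- Of the three cases of `related`, the one to exclude is `i ≡ τ (p i)`: there `p i` is a
  -- `τ`-descendant of `i`, so its path to `ρ` returns to `i` and closes a cycle.
  tight-parent : ∀ {p} → Rooted p → Tight p → ∀ {i} → i ≢ ρ → (p i ≢ ρ × κ (p i) ≡ κ i) ⊎ p i ≡ τ i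
  tight-parent {p} rooted tight {i} i≢ with related (parent≢ rooted i≢ ∘ ≡-sym) (tight i i≢)
  ... | inj₁ (_ , j≢ , κ≡)      = inj₁ (j≢ , κ≡)
  ... | inj₂ (inj₁ (_ , e))     = inj₂ e
  ... | inj₂ (inj₂ (j≢ , i≡τj)) = contradiction
    (leave-descendants rooted tight i≢ (rooted (p i)) (up j≢ (subst (Above τ i) i≡τj here)))
    (no-cycle (rooted i) i≢)

  -- Whichever parent `i` has, the edge to it carries the separator `κ i`. This is why
  -- multiplicities do not depend on the clique tree.
  tight-∩ : ∀ {p} → Rooted p → Tight p → ∀ i → i ≢ ρ → Q i ∩ Q (p i) ≡ κ i
  tight-∩ rooted tight i i≢ with tight-parent rooted tight i≢
  ... | inj₁ (j≢ , κ≡) = Q∩Qsibling≡κ i≢ j≢ (parent≢ rooted i≢) κ≡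
  ... | inj₂ e         = trans (cong (λ j → Q i ∩ Q j) e) (Q∩Qτ≡κ i≢)

  -- The root clique stays among the vertices, with a label of its own. Its class has one member and
  -- contributes the factor (1 + 1)^0 = 1, which spares a renumbering of the other cliques.
  label : Fin m → Maybe (Subset n)
  label i = if does (i Fin.≟ ρ) then nothing else just (κ i)

  labels : Vec (Maybe (Subset n)) m
  labels = tabulate label

  lookup-ρ : lookup labels ρ ≡ nothing
  lookup-ρ rewrite Vec.lookup∘tabulate label ρ with ρ Fin.≟ ρ
  ... | yes _ = refl
  ... | no ρ≢ = contradiction refl ρ≢

  lookup-≢ρ : ∀ {i} → i ≢ ρ → lookup labels i ≡ just (κ i)
  lookup-≢ρ {i} i≢ rewrite Vec.lookup∘tabulate label i with i Fin.≟ ρ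
  ... | yes i≡ = contradiction i≡ i≢
  ... | no _   = refl

  classmate⁻ : ∀ {i j} → i ≢ ρ → lookup labels j ≡ lookup labels i → j ≢ ρ × κ j ≡ κ i
  classmate⁻ {i} {j} i≢ e with j Fin.≟ ρ
  ... | yes refl with () ← trans (≡-sym lookup-ρ) (trans e (lookup-≢ρ i≢))
  ... | no j≢    = j≢ , Maybe.just-injective (trans (≡-sym (lookup-≢ρ j≢)) (trans e (lookup-≢ρ i≢)))

  classmate⁺ : ∀ {i j} → i ≢ ρ → j ≢ ρ → κ j ≡ κ i → lookup labels j ≡ lookup labels i
  classmate⁺ i≢ j≢ e = trans (lookup-≢ρ j≢) (trans (cong just e) (≡-sym (lookup-≢ρ i≢)))

  -- Cliques with the same separator have the same `τ`; so `τ i` would be a fixed point of `τ` other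
  -- than `ρ`.
  τ-no-classmate : ∀ {i} → i ≢ ρ → lookup labels (τ i) ≢ lookup labels i
  τ-no-classmate {i} i≢ e with j≢ , κ≡ ← classmate⁻ i≢ e =
    τ≢ j≢ (κ≡⇒τ≡ j≢ i≢ κ≡)

  _≟ₛ_ : DecidableEquality (Subset n)
  _≟ₛ_ = Vec.≡-dec Bool._≟_

  _≟ₗ_ : DecidableEquality (Maybe (Subset n))
  _≟ₗ_ = Maybe.≡-dec _≟ₛ_

  -- The bijection between forests and clique trees

  open LabelledForests _≟ₗ_ labels

  -- The root of the forest on a class stands for the first clique containing the common separator,
  -- which is `τ i` for each member `i` of the class.
  resolve : Fin m → Maybe (Fin m) → Fin m
  resolve i nothing  = τ i
  resolve i (just j) = j

  parentOf : Vec (Maybe (Fin m)) m → Fin m → Fin m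
  parentOf f i = resolve i (lookup f i)

  forest-classmate : ∀ {f} → Valid labels id f → ∀ {i j} → i ≢ ρ → lookup f i ≡ just j →
                     j ≢ ρ × κ j ≡ κ i
  forest-classmate {f} (mem , _) {i} i≢ e =
    classmate⁻ i≢ (just-∈-parents⁻ (subst (_∈ parents _) e (mem i)))

  -- The recursion is lexicographic. Inside a class `τ` is constant and the `Grounded` derivation
  -- shrinks; leaving the class leads to `τ i`, and the rank of its own `τ` is smaller. Ranks of the
  -- cliques themselves would not do, since a classmate may be older or younger.
  forest-rooted : ∀ {f} → Valid labels id f → Rooted (parentOf f)
  forest-rooted {f} valid@(_ , grounded) i =
    go (suc (rank (Q (τ i)))) (i Fin.≟ ρ) (λ _ → ℕ.≤-refl) (grounded i)
    where
    go : ∀ b {i} → Dec (i ≡ ρ) → (i ≢ ρ → rank (Q (τ i)) < b) → Grounded id f i → Above (parentOf f) ρ i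
    go b       (yes refl)     lt g        = here
    go zero    (no i≢)        lt g        with () ← lt i≢
    go (suc b) {i} (no i≢)    lt (root e) = up i≢ (subst (Above (parentOf f) ρ) (cong (resolve i) (≡-sym e))
      (go b (τ i Fin.≟ ρ) (λ τi≢ → ℕ.<-≤-trans (rank-τ τi≢) (ℕ.≤-pred (lt i≢))) (grounded (τ i))))
    go (suc b) {i} (no i≢)    lt (via e g) =
      let j≢ , κ≡ = forest-classmate valid i≢ e in
      up i≢ (subst (Above (parentOf f) ρ) (cong (resolve i) (≡-sym e))
        (go (suc b) (no j≢) (λ _ → subst (λ t → rank (Q t) < suc b) (≡-sym (κ≡⇒τ≡ j≢ i≢ κ≡)) (lt i≢)) g))

  forest-tight : ∀ {f} → Valid labels id f → Tight (parentOf f)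
  forest-tight {f} valid@(_ , grounded) i i≢ = go (lookup f i) refl
    where
    go : ∀ y → lookup f i ≡ y → ∣ Q i ∩ Q (resolve i y) ∣ ≡ k
    go nothing  e = τ-tight i i≢
    go (just j) e with j≢ , κ≡ ← forest-classmate valid i≢ e =
      trans (cong ∣_∣ (Q∩Qsibling≡κ i≢ j≢ (λ { refl → grounded-irrefl (grounded i) e }) κ≡))
        (proj₂ (κ-ok i≢))

  choice : (Fin m → Fin m) → Fin m → Maybe (Fin m)
  choice p i with i Fin.≟ ρ | lookup labels (p i) ≟ₗ lookup labels i
  ... | no _ | yes _ = just (p i)
  ... | _    | _     = nothing

  module _ {p : Fin m → Fin m} (rooted : Rooted p) (tight : Tight p) where

    choice-∈ : ∀ i → choice p i ∈ parents (lookup labels i)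
    choice-∈ i with i Fin.≟ ρ | lookup labels (p i) ≟ₗ lookup labels i
    ... | no _  | yes e = just-∈-parents⁺ e
    ... | no _  | no _  = here refl
    ... | yes _ | _     = here refl

    choice-cases : ∀ i → choice p i ≡ nothing ⊎ choice p i ≡ just (p i)
    choice-cases i with i Fin.≟ ρ | lookup labels (p i) ≟ₗ lookup labels i
    ... | no _  | yes e = inj₂ refl
    ... | no _  | no _  = inj₁ refl
    ... | yes _ | _     = inj₁ refl

    choice-ρ : choice p ρ ≡ nothing
    choice-ρ with ρ Fin.≟ ρ
    ... | yes _ = refl
    ... | no ρ≢ = contradiction refl ρ≢

    resolve-choice : ∀ i → i ≢ ρ → resolve i (choice p i) ≡ p i
    resolve-choice i i≢ with i Fin.≟ ρ | lookup labels (p i) ≟ₗ lookup labels i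
    ... | yes i≡ | _     = contradiction i≡ i≢
    ... | no _   | yes _ = refl
    ... | no _   | no ne with tight-parent rooted tight i≢
    ...   | inj₁ (j≢ , κ≡) = contradiction (classmate⁺ i≢ j≢ κ≡) ne
    ...   | inj₂ e         = ≡-sym e

    forestOf : Vec (Maybe (Fin m)) m
    forestOf = tabulate (choice p)

    forestOf-grounded : ∀ {i} → Above p ρ i → Grounded id forestOf i
    forestOf-grounded here = root (trans (Vec.lookup∘tabulate (choice p) ρ) choice-ρ)
    forestOf-grounded {i} (up _ h) with choice-cases i
    ... | inj₁ e = root (trans (Vec.lookup∘tabulate (choice p) i) e)
    ... | inj₂ e = via (trans (Vec.lookup∘tabulate (choice p) i) e) (forestOf-grounded h)

    forestOf-valid : Valid labels id forestOf
    forestOf-valid =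
      (λ i → subst (_∈ parents _) (≡-sym (Vec.lookup∘tabulate (choice p) i)) (choice-∈ i))
      , (λ i → forestOf-grounded (rooted i))

    parentOf-forestOf : ∀ i → i ≢ ρ → parentOf forestOf i ≡ p i
    parentOf-forestOf i i≢ =
      trans (cong (resolve i) (Vec.lookup∘tabulate (choice p) i)) (resolve-choice i i≢)

  forest-root : ∀ {f} → Valid labels id f → lookup f ρ ≡ nothing
  forest-root {f} (mem , grounded) = go (lookup f ρ) refl
    where
    go : ∀ y → lookup f ρ ≡ y → y ≡ nothing
    go nothing  _ = refl
    go (just j) e with j Fin.≟ ρ
    ... | yes refl = contradiction e (grounded-irrefl (grounded ρ))
    ... | no j≢ with () ← trans (≡-sym (lookup-≢ρ j≢))
          (trans (just-∈-parents⁻ (subst (_∈ parents _) e (mem ρ))) lookup-ρ)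

  -- The tree determines the parents off `ρ`, and a parent determines the option chosen: `τ i` is
  -- never a classmate of `i`, so `nothing` and `just j` resolve differently. At `ρ` every forest
  -- chooses `nothing`.
  forest-injective : ∀ {f g} → Valid labels id f → Valid labels id g →
                     treeOf (parentOf f) ≡ treeOf (parentOf g) → f ≡ g
  forest-injective {f} {g} vf vg eq =
    trans (≡-sym (Vec.tabulate∘lookup f)) (trans (Vec.tabulate-cong same) (Vec.tabulate∘lookup g))
    where
    clash : ∀ {f} → Valid labels id f → ∀ {i j} → i ≢ ρ → lookup f i ≡ just j → j ≢ τ i
    clash (mem , _) {i} i≢ e refl =
      τ-no-classmate i≢ (just-∈-parents⁻ (subst (_∈ parents _) e (mem i)))
    resolved : ∀ {i} → i ≢ ρ → ∀ y z → lookup f i ≡ y → lookup g i ≡ z →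
               resolve i y ≡ resolve i z → y ≡ z
    resolved i≢ nothing  nothing  _ _ _ = refl
    resolved i≢ (just _) (just _) _ _ e = cong just e
    resolved i≢ (just _) nothing  a _ e = contradiction e (clash vf i≢ a)
    resolved i≢ nothing  (just _) _ b e = contradiction (≡-sym e) (clash vg i≢ b)
    same : ∀ i → lookup f i ≡ lookup g i
    same i with i Fin.≟ ρ
    ... | yes refl = trans (forest-root vf) (≡-sym (forest-root vg))
    ... | no i≢    = resolved i≢ _ _ refl refl (treeOf-injective {parentOf f} (forest-rooted vg) eq i≢)

  cliqueTrees : List (EdgeSet m)
  cliqueTrees = map (treeOf ∘ parentOf) forests

  cliqueTrees-unique : Unique cliqueTrees
  cliqueTrees-unique = map-unique (treeOf ∘ parentOf) (enum-unique labels id)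
    λ f∈ g∈ → forest-injective (∈-enum⁻ labels id f∈) (∈-enum⁻ labels id g∈)

  ∈-cliqueTrees : ∀ E → (E ∈ cliqueTrees) ⇔ IsCliqueTree Q E
  ∈-cliqueTrees E = mk⇔ to from
    where
    to : E ∈ cliqueTrees → IsCliqueTree Q E
    to E∈ with f , f∈ , refl ← Membership.∈-map⁻ (treeOf ∘ parentOf) E∈ =
      let valid = ∈-enum⁻ labels id f∈ in tight⇒cliqueTree (forest-rooted valid) (forest-tight valid)
    from : IsCliqueTree Q E → E ∈ cliqueTrees
    from ct with p , rooted , tight , refl ← cliqueTree⇒tight {E} ct =
      -- The parent function recovered from the forest agrees with `p` off `ρ`, which is enough for
      -- the trees to be equal.
      subst (_∈ cliqueTrees) (treeOf-cong (parentOf-forestOf rooted tight))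
        (Membership.∈-map⁺ (treeOf ∘ parentOf) (∈-enum⁺ labels id (forestOf-valid rooted tight)))

  -- Multiplicities and the final count

  mult≡∑ : ∀ {N} ℓ (c : Vec (Maybe (Subset n)) N) →
           mult ℓ c ≡ ∑ (λ i → if does (lookup c i ≟ₗ ℓ) then 1 else 0)
  mult≡∑ ℓ []      = refl
  mult≡∑ ℓ (x ∷ c) = trans (cong ((if does (x ≟ₗ ℓ) then 1 else 0) +_) (mult≡∑ ℓ c))
    (≡-sym (∑-suc (λ i → if does (lookup (x ∷ c) i ≟ₗ ℓ) then 1 else 0)))

  mult-nothing : mult nothing labels ≡ 1
  mult-nothing = trans (mult≡∑ nothing labels) (trans (∑-cong same) (∑-single ρ (λ _ → 1)))
    where
    same : ∀ i → (if does (lookup labels i ≟ₗ nothing) then 1 else 0) ≡ (if does (ρ Fin.≟ i) then 1 else 0)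
    same i with ρ Fin.≟ i
    ... | yes refl rewrite lookup-ρ = refl
    ... | no ρ≢i rewrite lookup-≢ρ (ρ≢i ∘ ≡-sym) = refl

  -- Each clique other than `ρ` accounts for exactly one edge, the one to its parent, and by
  -- `tight-∩` that edge has intersection `κ i`.
  mult-just : ∀ {E} → IsCliqueTree Q E → ∀ S → mult (just S) labels ≡ μ Q E S
  mult-just {E} ct S with p , rooted , tight , refl ← cliqueTree⇒tight {E} ct = begin
    mult (just S) labels                                                 ≡⟨ mult≡∑ (just S) labels ⟩
    ∑ (λ i → if does (lookup labels i ≟ₗ just S) then 1 else 0)          ≡⟨ ∑-cong same ⟩
    sumBelowRoot (λ i → is-S (κ i))                                      ≡⟨ sumBelowRoot-cong (λ i i≢ → cong is-S (tight-∩ rooted tight i i≢)) ⟨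
    sumBelowRoot (λ i → is-S (Q i ∩ Q (p i)))                            ≡⟨ edgeSum-treeOf rooted _ (λ i j → cong is-S (Subset.∩-comm (Q i) (Q j))) ⟨
    μ Q (treeOf p) S                                                     ∎
    where
    open ≡-Reasoning
    is-S : Subset n → ℕ
    is-S X = if ⌊ X ≟ₛ S ⌋ then 1 else 0
    same : ∀ i → (if does (lookup labels i ≟ₗ just S) then 1 else 0)
               ≡ (if does (i Fin.≟ ρ) then 0 else is-S (κ i))
    same i rewrite Vec.lookup∘tabulate label i with does (i Fin.≟ ρ)
    ... | true  = refl
    ... | false with κ i ≟ₛ S
    ...   | yes _ = refl
    ...   | no _  = refl

  κ-isMVS : ∀ {i} → i ≢ ρ → IsMVS G (κ i)
  κ-isMVS {i} i≢ = separator-isMVS kTree (Q-ok i) (Q-ok (τ i)) (proj₂ (κ-ok i≢))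
    (λ e → τ≢ i≢ (≡-sym (Q-injective e))) (κ⊆Q i≢) (κ⊆Qτ i≢)

  length-cliqueTrees : (𝕊 : List (Subset n)) → Unique 𝕊 → (∀ S → (S ∈ 𝕊) ⇔ IsMVS G S) →
                       ∀ E → IsCliqueTree Q E →
                       length cliqueTrees ≡ prod (map (λ S → (μ Q E S + 1) ^ (μ Q E S ∸ 1)) 𝕊)
  length-cliqueTrees 𝕊 u𝕊 𝕊-mvs E ct = begin
    length cliqueTrees                     ≡⟨ List.length-map (treeOf ∘ parentOf) forests ⟩
    length forests                         ≡⟨ length-forests Λ uΛ labels∈Λ ⟩
    F (mult nothing labels) * product (map (λ ℓ → F (mult ℓ labels)) (map just 𝕊))
      ≡⟨ cong₂ _*_ (cong F mult-nothing) (cong product (≡-sym (List.map-∘ 𝕊))) ⟩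
    1 * product (map (λ S → F (mult (just S) labels)) 𝕊)
      ≡⟨ ℕ.*-identityˡ _ ⟩
    product (map (λ S → F (mult (just S) labels)) 𝕊)
      ≡⟨ cong product (List.map-cong (λ S → cong F (mult-just {E} ct S)) 𝕊) ⟩
    product (map (λ S → F (μ Q E S)) 𝕊)    ∎
    where
    open ≡-Reasoning
    F : ℕ → ℕ
    F a = (a + 1) ^ (a ∸ 1)
    -- `length-forests` takes a list containing every label that occurs: that of `ρ`, and the
    -- separators `κ i`, which lie in `𝕊` by `κ-isMVS`.
    Λ : List (Maybe (Subset n))
    Λ = nothing ∷ map just 𝕊
    uΛ : Unique Λ
    uΛ = All.tabulate fresh ∷ Unique.map⁺ Maybe.just-injective u𝕊
      where
      fresh : ∀ {ℓ} → ℓ ∈ map just 𝕊 → nothing ≢ ℓ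
      fresh ℓ∈ refl with _ , _ , () ← Membership.∈-map⁻ just ℓ∈
    labels∈Λ : ∀ i → lookup labels i ∈ Λ
    labels∈Λ i with i Fin.≟ ρ
    ... | yes refl = here lookup-ρ
    ... | no i≢    = subst (_∈ Λ) (≡-sym (lookup-≢ρ i≢))
      (there (Membership.∈-map⁺ just (Equivalence.from (𝕊-mvs (κ i)) (κ-isMVS i≢))))

theorem9 : ∀ {n} (k : ℕ) → 1 ≤ k → (G : Graph n) → KTree k G →
    (𝕊 : List (Subset n)) → Unique 𝕊 → (∀ S → (S ∈ 𝕊) ⇔ IsMVS G S) →
    (m : ℕ) (Q : Fin m → Subset n) → EnumMaxCliques G Q →
    (E₀ : EdgeSet m) → IsCliqueTree Q E₀ →
    ∃ λ (CT : List (EdgeSet m)) → Unique CT ×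
    (∀ E → (E ∈ CT) ⇔ IsCliqueTree Q E) ×
    length CT ≡ prod (map (λ S → (μ Q E₀ S + 1) ^ (μ Q E₀ S ∸ 1)) 𝕊)
theorem9 k 1≤k G kTree 𝕊 u𝕊 𝕊-mvs m Q Q-enum E₀ ct =
  cliqueTrees , cliqueTrees-unique , ∈-cliqueTrees , length-cliqueTrees 𝕊 u𝕊 𝕊-mvs E₀ ct
  where open CliqueTrees 1≤k kTree Q Q-enum
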